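{- Let $v(n)$, $v_1(n)$, $v_2(n)$ be the numbers of cells turned from OFF to ON at stage $n$ of the eight-neighbor automaton, its first corner version and its second corner version, respectively (defined in the context). Then: $v_1(0)=0$, $v_1(1)=1$, $v_1(2)=3$, $v_1(3)=5$, and for $k\ge2$, $$ v_1(2^k+i)=\begin{cases}(3k+1)2^{k-2}+1, & i=0;\\ 3\cdot2^{k-1}+3, & i=1;\\ 2v_1(i)+v_1(i+1), & i=2,\ldots,2^k-2;\\ 2v_1(i)+v_1(i+1)-1, & i=2^k-1;\end{cases} $$ $v_2(0)=0$, $v_2(1)=1$, and for $k\ge1$, $$ v_2(2^k+i)=\begin{cases}3\cdot2^k-1, & i=0;\\ v_2(i)+2v_1(i+1), & i=1,\ldots,2^k-2;\\ v_2(i)+2v_1(i+1)-2, & i=2^k-1;\end{cases} $$ $v(0)=0$, $v(1)=1$, and for $k\ge1$, $$ v(2^k+i)=\begin{cases}6\cdot2^k-4, & i=0;\\ 4v_2(i), & i=1,\ldots,2^k-1.\end{cases} $$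
   Context: Cells are the unit squares of the square grid; cell $(i,j)\in\mathbb Z\times\mathbb Z$ is the square $\{(x,y): i\le x\le i+1,\ j-1\le y\le j\}$. The neighbors of a cell are the eight cells surrounding it (sharing an edge or a corner). Cells are OFF or ON, and once ON stay ON. Eight-neighbor automaton: at stage $0$ no cell is ON; at stage $1$ a single cell is turned ON; at each stage $n\ge2$ an OFF cell turns ON if and only if exactly one of its eight neighbors was ON after stage $n-1$. First corner version: the third-quadrant cells are the cells $(i,j)$ with $i\le-1$, $j\le0$; at stage $1$ turn ON cell $(0,0)$; thereafter extend by the same eight-neighbor rule, with the proviso that after the first stage no ON cell may be adjacent (among its eight neighbors) to any third-quadrant cell. Second corner version: the same, except that at stage $1$ the cell $(0,1)$ is turned ON. All counts are $0$ at stage $0$. -}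

module Defs where

open import Data.Bool using (Bool; true; false; _∧_; _∨_; not; if_then_else_)
open import Data.Nat as ℕ using (ℕ; zero; suc)
open import Data.Integer as ℤ using (ℤ; +_; -[1+_]; _≤ᵇ_)
open import Data.Integer.Properties using () renaming (_≟_ to _≟ℤ_)
open import Data.Product using (_×_; _,_)
open import Data.List using (List; []; _∷_; map; filter; length; upTo; concatMap)
open import Relation.Nullary.Decidable using (⌊_⌋)

-- Cell (i , j) of the square grid, i.e. the unit square [i,i+1] × [j-1,j].
Cell : Set
Cell = ℤ × ℤ

_==ᶜ_ : Cell → Cell → Bool
(i , j) ==ᶜ (k , l) = ⌊ i ≟ℤ k ⌋ ∧ ⌊ j ≟ℤ l ⌋

neighbours : Cell → List Cell
neighbours (i , j) =
  (i ℤ.+ ℤ.-1ℤ , j ℤ.+ ℤ.-1ℤ) ∷ (i ℤ.+ ℤ.-1ℤ , j) ∷ (i ℤ.+ ℤ.-1ℤ , j ℤ.+ ℤ.1ℤ) ∷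
  (i , j ℤ.+ ℤ.-1ℤ) ∷ (i , j ℤ.+ ℤ.1ℤ) ∷
  (i ℤ.+ ℤ.1ℤ , j ℤ.+ ℤ.-1ℤ) ∷ (i ℤ.+ ℤ.1ℤ , j) ∷ (i ℤ.+ ℤ.1ℤ , j ℤ.+ ℤ.1ℤ) ∷ []

countTrue : List Bool → ℕ
countTrue [] = 0
countTrue (true ∷ bs) = suc (countTrue bs)
countTrue (false ∷ bs) = countTrue bs

isOne : ℕ → Bool
isOne 1 = true
isOne _ = false

on : Cell → (Cell → Bool) → ℕ → Cell → Bool
on s a zero c = false
on s a (suc zero) c = c ==ᶜ s
on s a (suc (suc n)) c =
  on s a (suc n) c ∨ (a c ∧ isOne (countTrue (map (on s a (suc n)) (neighbours c))))

turnsOn : Cell → (Cell → Bool) → ℕ → Cell → Bool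
turnsOn s a zero c = false
turnsOn s a (suc n) c = on s a (suc n) c ∧ not (on s a n c)

range : ℕ → List ℤ
range R = map (λ k → (+ k) ℤ.- (+ R)) (upTo (suc (R ℕ.+ R)))

box : ℕ → List Cell
box R = concatMap (λ i → map (λ j → (i , j)) (range R)) (range R)

-- number of cells turned ON at stage n.  All cells ON after stage n lie within
-- Chebyshev distance n-1 of the seed, hence (seeds (0,0),(0,1)) in box (n+1),
-- so counting over this box counts all of them.
count : Cell → (Cell → Bool) → ℕ → ℕ
count s a n = length (filter (λ c → turnsOn s a n c ≟b true) (box (suc n)))
  where
  open import Relation.Nullary using (Dec; yes; no)
  open import Relation.Binary.PropositionalEquality using (_≡_; refl)
  _≟b_ : (x y : Bool) → Dec (x ≡ y)
  _≟b_ = Data.Bool._≟_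
    where import Data.Bool

everywhere : Cell → Bool
everywhere _ = true

thirdQuadrant : Cell → Bool
thirdQuadrant (i , j) = (i ≤ᵇ ℤ.-1ℤ) ∧ (j ≤ᵇ ℤ.0ℤ)

anyB : List Bool → Bool
anyB [] = false
anyB (b ∷ bs) = b ∨ anyB bs

cornerAllowed : Cell → Bool
cornerAllowed c = not (anyB (map thirdQuadrant (neighbours c)))

v : ℕ → ℕ
v = count (+ 0 , + 0) everywhere

v₁ : ℕ → ℕ
v₁ = count (+ 0 , + 0) cornerAllowed

v₂ : ℕ → ℕ
v₂ = count (+ 0 , + 1) cornerAllowed

-- All three automata are glued from copies of one sector.  Put the seed of the
-- second corner version at the origin and cut its plane along x = y.  The two
-- halves are mirror images; let h(n) be the number of cells of the half y < x
-- turned on at stage n.  A diagonal advances one cell per stage, ahead of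
-- everything else, and the line next to it is decided as soon as it is
-- reached, so the evolution on one side does not depend on the other.
-- Hence each half of the first corner version is again this half (one of them
-- a stage late), and each octant of the full automaton is its part 0 < y < x:
--   v₂(n) = 2 h(n) + 1,  v₁(n) = h(n) + h(n-1) + 1,  v(n) = 8 e(n) + 4,
-- where e counts the octant.  By symmetry in |y| < x, h = 2 e + 1 + g, with g
-- counting the cells below the antidiagonal.
--
-- Octant and lower part are wedges between a diagonal and a dead wall.  With
-- L = 2^k, every octant cell with x ≤ L is on or dead at stage L, or is not
-- yet reached and has x < L; the same holds below the antidiagonal for
-- -y ≤ L - 1 at stage L - 1.  The last column, resp. row, then acts as a dead
-- wall, and beyond it the wedge repeats the half plane from its start: thus
-- e(L + i) = h(i) and g(L + i) = h(i + 1), except that g(2L - 1) = h(L) - 1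
-- because one cell of the copy falls on the wall x = 0.  Copying also shows
-- that everything is decided up to 2L, which is the induction on k.

module Submission where

open import Defs
open import Data.Bool using (Bool; true; false; _∧_; _∨_; not)
import Data.Bool as Bool using (_≟_)
open import Data.Bool.Properties using (∧-zeroʳ; ∧-identityʳ; ∧-comm)
open import Data.Integer as ℤ using (ℤ; +_; -[1+_]; ∣_∣; _⊖_)
import Data.Integer.Properties as ℤₚ
open import Data.List using (List; []; _∷_; _++_; map; filter; length; upTo; applyUpTo; concatMap)
open import Data.List.Relation.Unary.All as All using (All)
open import Data.Nat using (ℕ; zero; suc; _+_; _*_; _∸_; _^_; _≤_; _<_; _<ᵇ_; z≤n; s≤s; s≤s⁻¹)
open import Data.Nat.Properties
open import Data.Nat.Tactic.RingSolver using (solve-∀; solve)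
open import Data.Product using (_×_; _,_; ∃; proj₁; proj₂)
open import Data.Sum using (_⊎_; inj₁; inj₂)
open import Relation.Binary.Definitions using (tri<; tri≈; tri>)
open import Relation.Binary.PropositionalEquality using (_≡_; _≢_; refl; sym; trans; cong; cong₂; subst; module ≡-Reasoning)
open import Relation.Nullary using (contradiction; yes; no)
open import Relation.Nullary.Decidable using (⌊_⌋)

-- Live-neighbour counts, comparisons and parity

⟦_⟧ : Bool → ℕ
⟦ true ⟧ = 1
⟦ false ⟧ = 0

cnt : (a b c d e f g h : Bool) → ℕ
cnt a b c d e f g h = ⟦ a ⟧ + (⟦ b ⟧ + (⟦ c ⟧ + (⟦ d ⟧ + (⟦ e ⟧ + (⟦ f ⟧ + (⟦ g ⟧ + ⟦ h ⟧))))))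

cnt-cong : ∀ {a b c d e f g h a′ b′ c′ d′ e′ f′ g′ h′} →
  a ≡ a′ → b ≡ b′ → c ≡ c′ → d ≡ d′ → e ≡ e′ → f ≡ f′ → g ≡ g′ → h ≡ h′ →
  cnt a b c d e f g h ≡ cnt a′ b′ c′ d′ e′ f′ g′ h′
cnt-cong refl refl refl refl refl refl refl refl = refl

cnt-mono : ∀ {a b c d e f g h a′ b′ c′ d′ e′ f′ g′ h′} →
  ⟦ a ⟧ ≤ ⟦ a′ ⟧ → ⟦ b ⟧ ≤ ⟦ b′ ⟧ → ⟦ c ⟧ ≤ ⟦ c′ ⟧ → ⟦ d ⟧ ≤ ⟦ d′ ⟧ →
  ⟦ e ⟧ ≤ ⟦ e′ ⟧ → ⟦ f ⟧ ≤ ⟦ f′ ⟧ → ⟦ g ⟧ ≤ ⟦ g′ ⟧ → ⟦ h ⟧ ≤ ⟦ h′ ⟧ →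
  cnt a b c d e f g h ≤ cnt a′ b′ c′ d′ e′ f′ g′ h′
cnt-mono p q r s t u v w =
  +-mono-≤ p (+-mono-≤ q (+-mono-≤ r (+-mono-≤ s (+-mono-≤ t (+-mono-≤ u (+-mono-≤ v w))))))

∨-mono : ∀ b c → ⟦ b ⟧ ≤ ⟦ b ∨ c ⟧
∨-mono true c = ≤-refl
∨-mono false c = z≤n

∧-mono : ∀ b {c d} → ⟦ c ⟧ ≤ ⟦ d ⟧ → ⟦ b ∧ c ⟧ ≤ ⟦ b ∧ d ⟧
∧-mono true p = p
∧-mono false p = z≤n

⟦⟧-true : ∀ {b c} → ⟦ b ⟧ ≤ ⟦ c ⟧ → b ≡ true → c ≡ true
⟦⟧-true {c = true} p refl = refl
⟦⟧-true {c = false} () refl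

isOne-many : ∀ {c} → 2 ≤ c → isOne c ≡ false
isOne-many (s≤s (s≤s p)) = refl

<ᵇ-true : ∀ {m n} → m < n → (m <ᵇ n) ≡ true
<ᵇ-true {zero} (s≤s p) = refl
<ᵇ-true {suc m} (s≤s p) = <ᵇ-true p

<ᵇ-false : ∀ {m n} → n ≤ m → (m <ᵇ n) ≡ false
<ᵇ-false {zero} z≤n = refl
<ᵇ-false {suc m} z≤n = refl
<ᵇ-false (s≤s p) = <ᵇ-false p

<ᵇ-suc : ∀ m n → ⟦ m <ᵇ n ⟧ ≤ ⟦ m <ᵇ suc n ⟧
<ᵇ-suc m zero = z≤n
<ᵇ-suc zero (suc n) = ≤-refl
<ᵇ-suc (suc m) (suc n) = <ᵇ-suc m n

<ᵇ-+ : ∀ k m n → (m + k <ᵇ n + k) ≡ (m <ᵇ n)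
<ᵇ-+ k m n with <-≤-connex m n
... | inj₁ p = trans (<ᵇ-true (+-monoˡ-< k p)) (sym (<ᵇ-true p))
... | inj₂ p = trans (<ᵇ-false (+-monoˡ-≤ k p)) (sym (<ᵇ-false p))

odd : ℕ → Bool
odd 0 = false
odd 1 = true
odd (suc (suc n)) = odd n

odd-suc : ∀ n → odd (suc n) ≡ not (odd n)
odd-suc 0 = refl
odd-suc 1 = refl
odd-suc (suc (suc n)) = odd-suc n

odd-+-even : ∀ m {k} → odd k ≡ false → odd (m + k) ≡ odd m
odd-+-even 0 p = p
odd-+-even 1 {k} p = trans (odd-suc k) (cong not p)
odd-+-even (suc (suc m)) p = odd-+-even m p

-- A cell on an advancing front: it is out of reach until stage N, and its
-- state is decided at once by the N-th configuration.
front : (f : ℕ → Bool) (c : ℕ → ℕ) (b : Bool) (N : ℕ) →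
  (∀ n → f (suc n) ≡ f n ∨ isOne (c n)) →
  (∀ n → n ≤ N → f n ≡ false) →
  c N ≡ suc ⟦ b ⟧ →
  (∀ n → c n ≤ c (suc n)) →
  ∀ n → f n ≡ not b ∧ (N <ᵇ n)
front f c b N step off cN mono n with <-≤-connex N n
... | inj₂ n≤N = trans (off n n≤N) (sym (trans (cong (not b ∧_) (<ᵇ-false n≤N)) (∧-zeroʳ (not b))))
... | inj₁ N<n = subst (λ n → f n ≡ not b ∧ (N <ᵇ n)) (m∸n+n≡m N<n)
                   (trans (late (n ∸ suc N))
                     (sym (trans (cong (not b ∧_) (<ᵇ-true (m≤n+m (suc N) (n ∸ suc N)))) (∧-true (not b)))))
  where
  ∧-true : ∀ b → b ∧ true ≡ b
  ∧-true true = refl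
  ∧-true false = refl
  isOne-suc : ∀ b → isOne (suc ⟦ b ⟧) ≡ not b
  isOne-suc true = refl
  isOne-suc false = refl
  grown : ∀ m → c N ≤ c (m + N)
  grown zero = ≤-refl
  grown (suc m) = ≤-trans (grown m) (mono (m + N))
  stays : ∀ b m → c N ≡ suc ⟦ b ⟧ → not b ∨ isOne (c (suc m + N)) ≡ not b
  stays false m e = refl
  stays true m e = isOne-many (≤-trans (≤-reflexive (sym e)) (grown (suc m)))
  late : ∀ m → f (m + suc N) ≡ not b
  late zero = trans (step N) (trans (cong₂ _∨_ (off N ≤-refl) (cong isOne cN)) (isOne-suc b))
  late (suc m) = trans (step (m + suc N))
    (trans (cong₂ (λ x k → x ∨ isOne (c k)) (late m) (+-suc m N)) (stays b m cN))

-- Evolution rules of the half plane and of the wedges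

-- The cell (x , x - d) of the second corner version, seed at the origin, for
-- x ≥ 0: d = 0 is the diagonal, d = 1 the line below it, x = 0 the dead wall.
around : (ℕ → ℕ → Bool) → ℕ → ℕ → ℕ
around f x d = cnt (f x d) (f x (1 + d)) (f x (2 + d)) (f (1 + x) (1 + d)) (f (1 + x) (3 + d))
                   (f (2 + x) (2 + d)) (f (2 + x) (3 + d)) (f (2 + x) (4 + d))

H : ℕ → ℕ → ℕ → Bool
H n x zero = x <ᵇ n
H n zero (suc d) = false
H n (suc x) (suc zero) = odd (suc x) ∧ (suc x <ᵇ n)
H zero (suc x) (suc (suc d)) = false
H (suc n) (suc x) (suc (suc d)) = H n (suc x) (suc (suc d)) ∨ isOne (around (H n) x d)

-- A wedge between a dead wall t = 0 and a diagonal s = 0.  For p = 0 it is an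
-- octant (t + s , t) of the quarter plane |y| < x, for p = 1 the part
-- (t , - (t + s)) of the fourth quadrant below the antidiagonal.
-- The neighbours are listed in the order of around, with x = t + s and d = s.
aroundW : (ℕ → ℕ → Bool) → ℕ → ℕ → ℕ
aroundW f t s = cnt (f (2 + t) s) (f (1 + t) (1 + s)) (f t (2 + s)) (f (2 + t) (1 + s)) (f t (3 + s))
                    (f (2 + t) (2 + s)) (f (1 + t) (3 + s)) (f t (4 + s))

-- The two wedges obey the same rule and differ only in the parity of the line `s = 1`, which is all
-- that `p` records.
W : ℕ → ℕ → ℕ → ℕ → Bool
W p n t zero = t <ᵇ n
W p n zero (suc s) = false
W p n (suc t) (suc zero) = odd (p + t) ∧ (suc (suc t) <ᵇ n)
W p zero (suc t) (suc (suc s)) = false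
W p (suc n) (suc t) (suc (suc s)) = W p n (suc t) (suc (suc s)) ∨ isOne (aroundW (W p n) t s)

H-mono : ∀ n x d → ⟦ H n x d ⟧ ≤ ⟦ H (suc n) x d ⟧
H-mono n x zero = <ᵇ-suc x n
H-mono n zero (suc d) = z≤n
H-mono n (suc x) (suc zero) = ∧-mono (odd (suc x)) (<ᵇ-suc (suc x) n)
H-mono n (suc x) (suc (suc d)) = ∨-mono (H n (suc x) (suc (suc d))) _

around-mono : ∀ n x d → around (H n) x d ≤ around (H (suc n)) x d
around-mono n x d = cnt-mono (H-mono n x d) (H-mono n x (1 + d)) (H-mono n x (2 + d))
  (H-mono n (1 + x) (1 + d)) (H-mono n (1 + x) (3 + d))
  (H-mono n (2 + x) (2 + d)) (H-mono n (2 + x) (3 + d)) (H-mono n (2 + x) (4 + d))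

W-mono : ∀ p n t s → ⟦ W p n t s ⟧ ≤ ⟦ W p (suc n) t s ⟧
W-mono p n t zero = <ᵇ-suc t n
W-mono p n zero (suc s) = z≤n
W-mono p n (suc t) (suc zero) = ∧-mono (odd (p + t)) (<ᵇ-suc (suc (suc t)) n)
W-mono p n (suc t) (suc (suc s)) = ∨-mono (W p n (suc t) (suc (suc s))) _

aroundW-mono : ∀ p n t s → aroundW (W p n) t s ≤ aroundW (W p (suc n)) t s
aroundW-mono p n t s = cnt-mono (W-mono p n (2 + t) s) (W-mono p n (1 + t) (1 + s)) (W-mono p n t (2 + s))
  (W-mono p n (2 + t) (1 + s)) (W-mono p n t (3 + s))
  (W-mono p n (2 + t) (2 + s)) (W-mono p n (1 + t) (3 + s)) (W-mono p n t (4 + s))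

∨-false : ∀ {b c} → b ≡ false → c ≡ 0 → b ∨ isOne c ≡ false
∨-false refl refl = refl

-- Growth spreads by at most one cell per stage: as long as all neighbours are out of reach the
-- count is 0. Here the bound is on `x`; `H-reach-y` bounds the depth `d - x`, and `W-reach` the
-- distance `t + s`.
H-reach-x : ∀ n x d → n ≤ x → H n x d ≡ false
H-reach-x n x zero p = <ᵇ-false p
H-reach-x n zero (suc d) p = refl
H-reach-x n (suc x) (suc zero) p = trans (cong (odd (suc x) ∧_) (<ᵇ-false p)) (∧-zeroʳ _)
H-reach-x zero (suc x) (suc (suc d)) p = refl
H-reach-x (suc n) (suc x) (suc (suc d)) (s≤s p) = ∨-false (H-reach-x n (suc x) (suc (suc d)) q)
  (cnt-cong (H-reach-x n x d p) (H-reach-x n x (1 + d) p) (H-reach-x n x (2 + d) p)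
    (H-reach-x n (1 + x) (1 + d) q) (H-reach-x n (1 + x) (3 + d) q)
    (H-reach-x n (2 + x) (2 + d) r) (H-reach-x n (2 + x) (3 + d) r) (H-reach-x n (2 + x) (4 + d) r))
  where
  q = m≤n⇒m≤1+n p
  r = m≤n⇒m≤1+n q

H-reach-y : ∀ n x d → n + x ≤ d → H n x d ≡ false
H-reach-y zero x zero p = refl
H-reach-y n zero (suc d) p = refl
H-reach-y zero (suc x) (suc zero) p = ∧-zeroʳ (odd (suc x))
H-reach-y (suc n) (suc x) (suc zero) (s≤s p) = contradiction (≤-trans (m≤n+m (suc x) n) p) λ ()
H-reach-y zero (suc x) (suc (suc d)) p = refl
H-reach-y (suc n) (suc x) (suc (suc d)) (s≤s p) = ∨-false (H-reach-y n (suc x) (suc (suc d)) (m≤n⇒m≤1+n p))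
  (cnt-cong (H-reach-y n x d r) (H-reach-y n x (1 + d) (m≤n⇒m≤1+n r)) (H-reach-y n x (2 + d) (m≤n⇒m≤1+n (m≤n⇒m≤1+n r)))
    (H-reach-y n (1 + x) (1 + d) p) (H-reach-y n (1 + x) (3 + d) (m≤n⇒m≤1+n (m≤n⇒m≤1+n p)))
    (H-reach-y n (2 + x) (2 + d) q) (H-reach-y n (2 + x) (3 + d) (m≤n⇒m≤1+n q)) (H-reach-y n (2 + x) (4 + d) (m≤n⇒m≤1+n (m≤n⇒m≤1+n q))))
  where
  r : n + x ≤ d
  r = s≤s⁻¹ (subst (_≤ suc d) (+-suc n x) p)
  q : n + suc (suc x) ≤ suc (suc d)
  q = subst (_≤ suc (suc d)) (sym (+-suc n (suc x))) (s≤s p)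

W-reach : ∀ p n t s → n ≤ t + s → W p n t s ≡ false
W-reach p n t zero q = <ᵇ-false (subst (n ≤_) (+-identityʳ t) q)
W-reach p n zero (suc s) q = refl
W-reach p n (suc t) (suc zero) q =
  trans (cong (odd (p + t) ∧_) (<ᵇ-false (subst (n ≤_) (cong suc (trans (+-suc t 0) (cong suc (+-identityʳ t)))) q))) (∧-zeroʳ _)
W-reach p zero (suc t) (suc (suc s)) q = refl
W-reach p (suc n) (suc t) (suc (suc s)) (s≤s q) = ∨-false (W-reach p n (1 + t) (2 + s) (m≤n⇒m≤1+n q))
  (cnt-cong (W-reach p n (2 + t) s q′) (W-reach p n (1 + t) (1 + s) q″) (W-reach p n t (2 + s) q)
    (W-reach p n (2 + t) (1 + s) (m≤n⇒m≤1+n q″)) (W-reach p n t (3 + s) (≤-trans q (+-monoʳ-≤ t (n≤1+n _))))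
    (W-reach p n (2 + t) (2 + s) (m≤n⇒m≤1+n (m≤n⇒m≤1+n q))) (W-reach p n (1 + t) (3 + s) (m≤n⇒m≤1+n (≤-trans q (+-monoʳ-≤ t (n≤1+n _)))))
    (W-reach p n t (4 + s) (≤-trans q (+-monoʳ-≤ t (m≤n+m _ 2)))))
  where
  q″ : n ≤ suc t + suc s
  q″ = subst (n ≤_) (+-suc t (suc s)) q
  q′ : n ≤ suc (suc t) + s
  q′ = subst (n ≤_) (+-suc (suc t) s) q″

-- The antidiagonal and the two lines beside it

-- Doubling by recursion, so that `dbl (suc x)` exposes the two successors on which the last clause
-- of `H` matches.
dbl : ℕ → ℕ
dbl zero = zero
dbl (suc n) = suc (suc (dbl n))

dbl≡+ : ∀ n → dbl n ≡ n + n
dbl≡+ zero = refl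
dbl≡+ (suc n) = cong suc (trans (cong suc (dbl≡+ n)) (sym (+-suc n n)))

+≤dbl : ∀ n → n + n ≤ dbl n
+≤dbl n = ≤-reflexive (sym (dbl≡+ n))

-- When the front arrives, the preceding cell of the antidiagonal is the only live neighbour; all
-- others are still out of reach.
H-antidiagonal : ∀ n x → H n x (dbl x) ≡ (x <ᵇ n)
H-antidiagonal n zero = refl
H-antidiagonal n (suc x) = front (λ n → H n (suc x) (dbl (suc x))) (λ n → around (H n) x (dbl x)) false (suc x)
  (λ n → refl) (λ n → H-reach-x n (suc x) (dbl (suc x)))
  (cnt-cong (trans (H-antidiagonal (suc x) x) (<ᵇ-true (n<1+n x)))
    (H-reach-y (suc x) x _ (s≤s (+≤dbl x))) (H-reach-y (suc x) x _ (m≤n⇒m≤1+n (s≤s (+≤dbl x))))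
    (H-reach-x (suc x) (1 + x) (1 + dbl x) ≤-refl) (H-reach-x (suc x) (1 + x) (3 + dbl x) ≤-refl)
    (H-reach-x (suc x) (2 + x) (2 + dbl x) (n≤1+n _)) (H-reach-x (suc x) (2 + x) (3 + dbl x) (n≤1+n _))
    (H-reach-x (suc x) (2 + x) (4 + dbl x) (n≤1+n _)))
  (λ n → around-mono n x (dbl x)) n

∧-known : ∀ b {c} → c ≡ true → b ∧ c ≡ b
∧-known b refl = ∧-identityʳ b

-- On arrival the live neighbours are one cell of the antidiagonal and, if it is on, the preceding
-- cell of the same line. So on and off cells alternate; the line below the antidiagonal behaves
-- likewise, a stage later.
H-above-antidiagonal : ∀ n x → H n (suc x) (suc (dbl x)) ≡ odd (suc x) ∧ (suc x <ᵇ n)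
H-above-antidiagonal n zero = refl
H-above-antidiagonal n (suc x) = trans
  (front (λ n → H n (2 + x) (3 + dbl x)) (λ n → around (H n) (1 + x) (1 + dbl x)) (odd (suc x)) (2 + x)
    (λ n → refl) (λ n → H-reach-x n (2 + x) (3 + dbl x))
    (trans (cnt-cong
        (trans (H-above-antidiagonal (2 + x) x) (∧-known (odd (suc x)) (<ᵇ-true (n<1+n (suc x)))))
        (trans (H-antidiagonal (2 + x) (suc x)) (<ᵇ-true (n<1+n (suc x))))
        (H-reach-y (2 + x) (1 + x) (3 + dbl x) (s≤s (s≤s (subst (_≤ suc (dbl x)) (sym (+-suc x x)) (s≤s (+≤dbl x))))))
        (H-reach-x (2 + x) (2 + x) (2 + dbl x) ≤-refl) (H-reach-x (2 + x) (2 + x) (4 + dbl x) ≤-refl)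
        (H-reach-x (2 + x) (3 + x) (3 + dbl x) (n≤1+n _)) (H-reach-x (2 + x) (3 + x) (4 + dbl x) (n≤1+n _))
        (H-reach-x (2 + x) (3 + x) (5 + dbl x) (n≤1+n _)))
      (+-comm ⟦ odd (suc x) ⟧ 1))
    (λ n → around-mono n (1 + x) (1 + dbl x)) n)
  (cong (_∧ (2 + x <ᵇ n)) (sym (odd-suc (suc x))))

H-below-antidiagonal : ∀ n x → H n x (suc (dbl x)) ≡ odd x ∧ (suc x <ᵇ n)
H-below-antidiagonal n zero = refl
H-below-antidiagonal n (suc x) = trans
  (front (λ n → H n (1 + x) (3 + dbl x)) (λ n → around (H n) x (1 + dbl x)) (odd x) (2 + x)
    (λ n → refl)
    (λ n p → H-reach-y n (1 + x) (3 + dbl x)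
      (≤-trans (+-monoˡ-≤ (1 + x) p) (s≤s (s≤s (subst (_≤ suc (dbl x)) (sym (+-suc x x)) (s≤s (+≤dbl x)))))))
    (trans (cnt-cong
        (trans (H-below-antidiagonal (2 + x) x) (∧-known (odd x) (<ᵇ-true (n<1+n (suc x)))))
        (H-reach-y (2 + x) x (2 + dbl x) (s≤s (s≤s (+≤dbl x))))
        (H-reach-y (2 + x) x (3 + dbl x) (m≤n⇒m≤1+n (s≤s (s≤s (+≤dbl x)))))
        (trans (H-antidiagonal (2 + x) (suc x)) (<ᵇ-true (n<1+n (suc x))))
        (H-reach-y (2 + x) (1 + x) (4 + dbl x)
          (s≤s (s≤s (subst (_≤ suc (suc (dbl x))) (sym (+-suc x x)) (s≤s (m≤n⇒m≤1+n (+≤dbl x)))))))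
        (H-reach-x (2 + x) (2 + x) (3 + dbl x) ≤-refl) (H-reach-x (2 + x) (2 + x) (4 + dbl x) ≤-refl)
        (H-reach-x (2 + x) (2 + x) (5 + dbl x) ≤-refl))
      (+-comm ⟦ odd x ⟧ 1))
    (λ n → around-mono n x (1 + dbl x)) n)
  (cong (_∧ (2 + x <ᵇ n)) (sym (odd-suc x)))

-- Cutting the half plane into wedges

cnt-reflect : ∀ a b c d e f g h → cnt c b a e d h g f ≡ cnt a b c d e f g h
cnt-reflect a b c d e f g h = sums ⟦ a ⟧ ⟦ b ⟧ ⟦ c ⟧ ⟦ d ⟧ ⟦ e ⟧ ⟦ f ⟧ ⟦ g ⟧ ⟦ h ⟧
  where
  sums : ∀ a b c d e f g h →
    c + (b + (a + (e + (d + (h + (g + f)))))) ≡ a + (b + (c + (d + (e + (f + (g + h))))))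
  sums = solve-∀

-- The effect on the neighbours of the quarter turn that carries `(t , - (t + s))` to `(t + s , t)`.
cnt-turn : ∀ a b c d e f g h → cnt c e h b g a d f ≡ cnt a b c d e f g h
cnt-turn a b c d e f g h = sums ⟦ a ⟧ ⟦ b ⟧ ⟦ c ⟧ ⟦ d ⟧ ⟦ e ⟧ ⟦ f ⟧ ⟦ g ⟧ ⟦ h ⟧
  where
  sums : ∀ a b c d e f g h →
    c + (e + (h + (b + (g + (a + (d + f)))))) ≡ a + (b + (c + (d + (e + (f + (g + h))))))
  sums = solve-∀

right : ∀ t s {x} → t + suc s ≡ x → suc t + s ≡ x
right t s q = trans (sym (+-suc t s)) q

left : ∀ t s {x} → suc t + s ≡ x → t + suc s ≡ x
left t s q = trans (+-suc t s) q

grow : ∀ {b b′ c c′} → b ≡ b′ → c ≡ c′ → b ∨ isOne c ≡ b′ ∨ isOne c′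
grow refl refl = refl

-- The neighbours of an axis cell come in mirror pairs, apart from the two on the axis itself. The
-- next axis cell is off, and the previous one, `r`, is live at most together with the pair `a`.
-- Hence the count is even or at least 2.
even-pairs : ∀ a r b c → r ≡ a ⊎ r ≡ false → isOne (cnt a r a b b c false c) ≡ false
even-pairs true r b c _ = isOne-many (s≤s (≤-trans (s≤s z≤n) (m≤n+m _ ⟦ r ⟧)))
even-pairs false r true c (inj₁ refl) = refl
even-pairs false r true c (inj₂ refl) = refl
even-pairs false r false true (inj₁ refl) = refl
even-pairs false r false true (inj₂ refl) = refl
even-pairs false r false false (inj₁ refl) = refl
even-pairs false r false false (inj₂ refl) = refl

mutual
  -- All these identifications advance together, stage by stage: the axis stays dead because its two
  -- sides are mirror images, and each side is a wedge because the axis serves as its dead wall.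
  H-upper : ∀ n t s x → suc t + s ≡ x → H n x s ≡ W 0 n (suc t) s
  H-upper n t zero x q = cong (_<ᵇ n) (trans (sym q) (+-identityʳ (suc t)))
  H-upper n t (suc zero) x q with trans (sym q) (+-comm (suc t) 1)
  ... | refl = refl
  H-upper zero t (suc (suc s)) (suc x) q = refl
  H-upper (suc n) t (suc (suc s)) (suc x) q = grow (H-upper n t (suc (suc s)) (suc x) q) (H-upper-around n t s x q)

  -- The axis is a wall only from `(2 , 0)` on, since `(1 , 0)` does turn on. That suffices: a wedge
  -- cell with `s` at least 2 has no neighbour with `x < 2`.
  H-upper₀ : ∀ n t s x → t + suc (suc s) ≡ x → H n x (suc (suc s)) ≡ W 0 n t (suc (suc s))
  H-upper₀ n zero s x refl = H-axis n s
  H-upper₀ n (suc t) s x q = H-upper n t (suc (suc s)) x q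

  H-upper-around : ∀ n t s x → suc t + suc (suc s) ≡ suc x → around (H n) x s ≡ aroundW (W 0 n) t s
  H-upper-around n t s x q = cnt-cong
    (H-upper n (suc t) s x (right (1 + t) s (right t (1 + s) q₀))) (H-upper n t (1 + s) x (right t (1 + s) q₀)) (H-upper₀ n t s x q₀)
    (H-upper n (suc t) (1 + s) (1 + x) (right (1 + t) (1 + s) q)) (H-upper₀ n t (1 + s) (1 + x) (left t (2 + s) q))
    (H-upper n (suc t) (2 + s) (2 + x) (cong suc q)) (H-upper n t (3 + s) (2 + x) (left (1 + t) (2 + s) (cong suc q)))
    (H-upper₀ n t (2 + s) (2 + x) (left t (3 + s) (left (1 + t) (2 + s) (cong suc q))))
    where
    q₀ : t + suc (suc s) ≡ x
    q₀ = suc-injective q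

  H-axis : ∀ n s → H n (suc (suc s)) (suc (suc s)) ≡ false
  H-axis zero s = refl
  H-axis (suc n) s = trans (cong₂ (λ b c → b ∨ isOne c) (H-axis n s) (H-axis-around n s))
    (even-pairs (W 0 n 1 s) (H n (1 + s) (1 + s)) (W 0 n 1 (1 + s)) (W 0 n 1 (2 + s)) (H-axis-start n s))

  -- The live axis cell `(1 , 0)` is on at exactly the same stages as the diagonal cell `(1 , 1)`,
  -- so it cannot make the count at `(2 , 0)` equal to 1.
  H-axis-start : ∀ n s → H n (suc s) (suc s) ≡ W 0 n 1 s ⊎ H n (suc s) (suc s) ≡ false
  H-axis-start n zero = inj₁ refl
  H-axis-start n (suc s) = inj₂ (H-axis n s)

  H-axis-around : ∀ n s → around (H n) (suc s) s ≡
    cnt (W 0 n 1 s) (H n (suc s) (suc s)) (W 0 n 1 s) (W 0 n 1 (1 + s)) (W 0 n 1 (1 + s)) (W 0 n 1 (2 + s)) false (W 0 n 1 (2 + s))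
  H-axis-around n s = cnt-cong
    (H-upper n 0 s (1 + s) refl) (refl {x = H n (suc s) (suc s)}) (H-lower n 0 s (1 + s) (2 + s) refl refl)
    (H-upper n 0 (1 + s) (2 + s) refl) (H-lower n 0 (1 + s) (2 + s) (3 + s) refl refl)
    (H-upper n 0 (2 + s) (3 + s) refl) (H-axis n (suc s)) (H-lower n 0 (2 + s) (3 + s) (4 + s) refl refl)

  H-lower : ∀ n t s x d → suc t + s ≡ x → suc t + x ≡ d → H n x d ≡ W 0 n (suc t) s
  H-lower n t zero x d q r with trans (sym q) (+-identityʳ (suc t))
  ... | refl = trans (cong (H n x) (trans (sym r) (sym (dbl≡+ x)))) (H-antidiagonal n x)
  H-lower n t (suc zero) x d q r with trans (sym q) (+-comm (suc t) 1)
  ... | refl = trans (cong (H n (2 + t)) (trans (sym r) (trans (+-suc (suc t) (suc t)) (cong suc (sym (dbl≡+ (suc t)))))))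
                     (H-above-antidiagonal n (suc t))
  H-lower n t (suc (suc s)) (suc x) d q r =
    trans (cong (H n (suc x)) (trans (sym r) (cong suc (+-suc t x)))) (interior n)
    where
    interior : ∀ n → H n (suc x) (suc (suc (t + x))) ≡ W 0 n (suc t) (suc (suc s))
    interior zero = refl
    interior (suc n) = grow (interior n) (H-lower-around n t s x (t + x) q refl)

  H-lower₀ : ∀ n t s x d → t + suc (suc s) ≡ x → t + x ≡ d → H n x d ≡ W 0 n t (suc (suc s))
  H-lower₀ n zero s x d refl refl = H-axis n s
  H-lower₀ n (suc t) s x d q r = H-lower n t (suc (suc s)) x d q r

  H-lower-around : ∀ n t s x d → suc t + suc (suc s) ≡ suc x → t + x ≡ d → around (H n) x d ≡ aroundW (W 0 n) t s
  H-lower-around n t s x d q r = trans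
    (cnt-cong (H-lower₀ n t s x d q₀ r) (H-lower n t (1 + s) x (1 + d) (right t (1 + s) q₀) (cong suc r))
      (H-lower n (1 + t) s x (2 + d) (right (1 + t) s (right t (1 + s) q₀)) (cong (_+_ 2) r))
      (H-lower₀ n t (1 + s) (1 + x) (1 + d) (left t (2 + s) q) r₁) (H-lower n (1 + t) (1 + s) (1 + x) (3 + d) (right (1 + t) (1 + s) q) (cong (_+_ 2) r₁))
      (H-lower₀ n t (2 + s) (2 + x) (2 + d) (left t (3 + s) (left (1 + t) (2 + s) (cong suc q))) r₂)
      (H-lower n t (3 + s) (2 + x) (3 + d) (left (1 + t) (2 + s) (cong suc q)) (cong suc r₂))
      (H-lower n (1 + t) (2 + s) (2 + x) (4 + d) (cong suc q) (cong (_+_ 2) r₂)))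
    (cnt-reflect (W 0 n (2 + t) s) (W 0 n (1 + t) (1 + s)) (W 0 n t (2 + s)) (W 0 n (2 + t) (1 + s)) (W 0 n t (3 + s))
                 (W 0 n (2 + t) (2 + s)) (W 0 n (1 + t) (3 + s)) (W 0 n t (4 + s)))
    where
    q₀ : t + suc (suc s) ≡ x
    q₀ = suc-injective q
    r₁ : t + suc x ≡ suc d
    r₁ = trans (+-suc t x) (cong suc r)
    r₂ : t + suc (suc x) ≡ suc (suc d)
    r₂ = trans (+-suc t (suc x)) (cong suc r₁)

mutual
  -- A quarter turn makes the part below the antidiagonal a wedge with dead wall `x = 0`. Unlike at
  -- the axis, the deadness of this wall is part of the definition of `H`.
  H-gamma : ∀ n x e d → e + dbl x ≡ d → H n x d ≡ W 1 n x e
  H-gamma n x zero d refl = H-antidiagonal n x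
  H-gamma n zero (suc e) d refl = refl
  H-gamma n (suc x) (suc zero) d refl = H-below-antidiagonal n (suc x)
  H-gamma n (suc x) (suc (suc e)) d q = trans (cong (H n (suc x)) (trans (sym q) (shift e))) (interior n)
    where
    shift : ∀ e → 2 + (e + dbl (suc x)) ≡ 2 + (2 + e + dbl x)
    shift e = cong (_+_ 2) (trans (+-suc e (suc (dbl x))) (cong suc (+-suc e (dbl x))))
    interior : ∀ n → H n (suc x) (2 + (2 + e + dbl x)) ≡ W 1 n (suc x) (2 + e)
    interior zero = refl
    interior (suc n) = grow (interior n) (H-gamma-around n x e)

  H-gamma-around : ∀ n x e → around (H n) x (2 + e + dbl x) ≡ aroundW (W 1 n) x e
  H-gamma-around n x e = trans
    (cnt-cong (H-gamma n x (2 + e) d refl) (H-gamma n x (3 + e) (1 + d) refl) (H-gamma n x (4 + e) (2 + d) refl)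
      (H-gamma n (1 + x) (1 + e) (1 + d) (cong suc q)) (H-gamma n (1 + x) (3 + e) (3 + d) (cong (_+_ 3) q))
      (H-gamma n (2 + x) e (2 + d) r) (H-gamma n (2 + x) (1 + e) (3 + d) (cong suc r))
      (H-gamma n (2 + x) (2 + e) (4 + d) (cong (_+_ 2) r)))
    (cnt-turn (W 1 n (2 + x) e) (W 1 n (1 + x) (1 + e)) (W 1 n x (2 + e)) (W 1 n (2 + x) (1 + e)) (W 1 n x (3 + e))
              (W 1 n (2 + x) (2 + e)) (W 1 n (1 + x) (3 + e)) (W 1 n x (4 + e)))
    where
    d : ℕ
    d = 2 + e + dbl x
    q : e + dbl (suc x) ≡ d
    q = trans (+-suc e (suc (dbl x))) (cong suc (+-suc e (dbl x)))
    r : e + dbl (suc (suc x)) ≡ 2 + d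
    r = trans (+-suc e (suc (dbl (suc x)))) (cong suc (trans (+-suc e (dbl (suc x))) (cong suc q)))

-- Frozen wedges and the copies beyond them

-- The fate of a cell with state b and c live neighbours is decided: it is on,
-- off for ever, or (only where Q holds) not yet reached.
Status : Bool → ℕ → Set → Set
Status b c Q = b ≡ true ⊎ (2 ≤ c ⊎ (c ≡ 0 × Q))

Status-subst : ∀ {b b′ c c′ Q Q′} → b ≡ b′ → c ≡ c′ → (Q → Q′) → Status b c Q → Status b′ c′ Q′
Status-subst refl refl f (inj₁ on) = inj₁ on
Status-subst refl refl f (inj₂ (inj₁ two)) = inj₂ (inj₁ two)
Status-subst refl refl f (inj₂ (inj₂ (none , q))) = inj₂ (inj₂ (none , f q))

-- A cell at distance exactly `K` may not be left unreached: a neighbour at distance `K + 1` could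
-- still turn it on. Nearer than `K`, all neighbours lie in the region considered.
Settled : ℕ → ℕ → Set
Settled p K = ∀ t s → suc t + suc (suc s) ≤ K →
  Status (W p K (suc t) (suc (suc s))) (aroundW (W p K) t s) (suc t + suc (suc s) < K)

odd-+-2+ : ∀ p t → odd (p + suc (suc t)) ≡ odd (p + t)
odd-+-2+ p t = cong odd (trans (+-suc p (suc t)) (cong suc (+-suc p t)))

module Wedge (p K : ℕ) (even : odd (p + K) ≡ false) (settled : Settled p K) where

  mutual
    -- An on cell stays on, a count of 2 never decreases, and an unreached cell lies so far inside
    -- that its whole neighbourhood is frozen too, which keeps its count at 0.
    frozen : ∀ m t s → t + suc s ≤ K → W p (m + K) t (suc s) ≡ W p K t (suc s)
    frozen m zero s q = refl
    frozen m (suc t) zero q with m≤n⇒m<n∨m≡n (subst (_≤ K) (cong suc (+-comm t 1)) q)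
    ... | inj₁ lt = cong (odd (p + t) ∧_) (trans (<ᵇ-true (<-≤-trans lt (m≤n+m K m))) (sym (<ᵇ-true lt)))
    -- At distance `K` on the line `s = 1` the front passes only after stage `K`; evenness of
    -- `p + K` makes this one of the cells that stay off.
    ... | inj₂ eq = trans (cong (_∧ _) even′) (sym (cong (_∧ _) even′))
      where
      even′ : odd (p + t) ≡ false
      even′ = trans (sym (odd-+-2+ p t)) (trans (cong (λ k → odd (p + k)) eq) even)
    frozen zero (suc t) (suc s) q = refl
    frozen (suc m) (suc t) (suc s) q = trans (cong (_∨ isOne (aroundW (W p (m + K)) t s)) (frozen m (suc t) (suc s) q))
                                             (stays (W p K (suc t) (suc (suc s))) (frozen m (suc t) (suc s) q) (settled-later m t s q))
      where
      stays : ∀ b {b′ c Q} → b′ ≡ b → Status b′ c Q → b ∨ isOne c ≡ b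
      stays true _ _ = refl
      stays false off (inj₁ on) = contradiction (trans (sym on) off) λ ()
      stays false _ (inj₂ (inj₁ two)) = isOne-many two
      stays false _ (inj₂ (inj₂ (refl , _))) = refl

    frozen-around : ∀ m t s → suc t + suc (suc s) < K → aroundW (W p (m + K)) t s ≡ aroundW (W p K) t s
    frozen-around m t s q = cnt-cong (first s q) (frozen m (1 + t) s (bound (1 + t) (1 + s) 2 (solve (t ∷ s ∷ []))))
      (frozen m t (1 + s) (bound t (2 + s) 2 (solve (t ∷ s ∷ [])))) (frozen m (2 + t) s (bound (2 + t) (1 + s) 1 (solve (t ∷ s ∷ []))))
      (frozen m t (2 + s) (bound t (3 + s) 1 (solve (t ∷ s ∷ [])))) (frozen m (2 + t) (1 + s) (bound (2 + t) (2 + s) 0 (solve (t ∷ s ∷ []))))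
      (frozen m (1 + t) (2 + s) (bound (1 + t) (3 + s) 0 (solve (t ∷ s ∷ [])))) (frozen m t (3 + s) (bound t (4 + s) 0 (solve (t ∷ s ∷ []))))
      where
      within : ∀ {x} → x < K → ∀ t′ s′ j → suc x ≡ j + (t′ + s′) → t′ + s′ ≤ K
      within q t′ s′ j e = ≤-trans (≤-trans (m≤n+m (t′ + s′) j) (≤-reflexive (sym e))) q
      bound : ∀ t′ s′ j → suc (suc t + suc (suc s)) ≡ j + (t′ + s′) → t′ + s′ ≤ K
      bound = within q
      first : ∀ s → suc t + suc (suc s) < K → W p (m + K) (2 + t) s ≡ W p K (2 + t) s
      -- For `s = 0` this neighbour lies on the diagonal, which `frozen` does not cover; being
      -- nearer than `K` it is already on.
      first zero q = trans (<ᵇ-true (<-≤-trans q′ (m≤n+m K m))) (sym (<ᵇ-true q′))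
        where
        q′ : suc (suc t) < K
        q′ = <-trans (s≤s (≤-reflexive (sym (+-comm t 2)))) q
      first (suc s) q = frozen m (2 + t) s (within q (2 + t) (1 + s) 2 (solve (t ∷ s ∷ [])))

    settled-later : ∀ m t s → suc t + suc (suc s) ≤ K →
      Status (W p (m + K) (suc t) (suc (suc s))) (aroundW (W p (m + K)) t s) (suc t + suc (suc s) < K)
    settled-later m t s q with settled t s q
    ... | inj₁ on = inj₁ (persist m)
      where
      persist : ∀ m → W p (m + K) (suc t) (suc (suc s)) ≡ true
      persist zero = on
      persist (suc m) = ⟦⟧-true (W-mono p (m + K) (suc t) (suc (suc s))) (persist m)
    ... | inj₂ (inj₁ two) = inj₂ (inj₁ (persist m))
      where
      persist : ∀ m → 2 ≤ aroundW (W p (m + K)) t s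
      persist zero = two
      persist (suc m) = ≤-trans (persist m) (aroundW-mono p (m + K) t s)
    ... | inj₂ (inj₂ (none , lt)) = inj₂ (inj₂ (trans (frozen-around m t s lt) none , lt))

  -- At stage `K` these cells are just out of reach, hence off, and being frozen they remain off.
  -- They become the dead wall of the copy.
  wall : ∀ m t s → t + suc s ≡ K → W p (m + K) t (suc s) ≡ false
  wall m t s q = trans (frozen m t s (≤-reflexive q)) (W-reach p K t (suc s) (≤-reflexive (sym q)))

  mutual
    copy : ∀ n t d a → n ≤ K → t + d ≡ a + K → W p (n + K) t d ≡ H n a d
    copy n t zero a n≤K q = trans (cong (_<ᵇ n + K) (trans (sym (+-identityʳ t)) q)) (<ᵇ-+ K a n)
    copy n zero (suc d) a n≤K q = sym (H-reach-y n a (suc d)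
      (subst (n + a ≤_) (sym q) (≤-trans (+-monoˡ-≤ a n≤K) (≤-reflexive (+-comm K a)))))
    copy n (suc t) (suc d) a n≤K q = copy⁺ n t (suc d) a (m≤n⇒m≤1+n n≤K) q

    -- Off the old wall the copy is exact for one stage more: a discrepancy on `t = 0` at stage
    -- `suc K + K` affects its neighbours only at the next stage.
    copy⁺ : ∀ n t d a → n ≤ suc K → suc t + d ≡ a + K → W p (n + K) (suc t) d ≡ H n a d
    copy⁺ n t zero a n≤K q = trans (cong (_<ᵇ n + K) (trans (sym (+-identityʳ (suc t))) q)) (<ᵇ-+ K a n)
    copy⁺ n t (suc d) zero n≤K q = wall n (suc t) d q
    copy⁺ n t (suc zero) (suc a) n≤K q = cong₂ _∧_ parity (trans (cong (_<ᵇ n + K) q′) (<ᵇ-+ K (suc a) n))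
      where
      q′ : suc (suc t) ≡ suc a + K
      q′ = trans (cong suc (sym (+-comm t 1))) q
      parity : odd (p + t) ≡ odd (suc a)
      parity = trans (sym (odd-+-2+ p t)) (trans (cong (λ k → odd (p + k)) q′)
        (trans (cong odd {x = p + (suc a + K)} {y = suc a + (p + K)} (solve (p ∷ a ∷ K ∷ []))) (odd-+-even (suc a) {p + K} even)))
    copy⁺ zero t (suc (suc s)) (suc a) n≤K q = W-reach p K (suc t) (suc (suc s)) (subst (K ≤_) (sym q) (m≤n+m K (suc a)))
    copy⁺ (suc n) t (suc (suc s)) (suc a) n≤K q =
      grow (copy⁺ n t (suc (suc s)) (suc a) (≤-trans (n≤1+n n) n≤K) q) (copy-around n t s a (s≤s⁻¹ n≤K) q)

    copy-around : ∀ n t s a → n ≤ K → suc t + suc (suc s) ≡ suc a + K → aroundW (W p (n + K)) t s ≡ around (H n) a s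
    copy-around n t s a n≤K q = copy-around-near n t s a (m≤n⇒m≤1+n n≤K) q
      (copy n t (2 + s) a n≤K (suc-injective q)) (copy n t (3 + s) (1 + a) n≤K (left t (2 + s) q))
      (copy n t (4 + s) (2 + a) n≤K (left t (3 + s) (left (1 + t) (2 + s) (cong suc q))))

    -- The three neighbours that may lie on the old wall are supplied by hypothesis, which makes the
    -- comparison available at `n = suc K`, where `copy` no longer applies.
    copy-around-near : ∀ n t s a → n ≤ suc K → suc t + suc (suc s) ≡ suc a + K →
      W p (n + K) t (2 + s) ≡ H n a (2 + s) → W p (n + K) t (3 + s) ≡ H n (1 + a) (3 + s) → W p (n + K) t (4 + s) ≡ H n (2 + a) (4 + s) →
      aroundW (W p (n + K)) t s ≡ around (H n) a s
    copy-around-near n t s a n≤K q e₁ e₂ e₃ = cnt-cong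
      (copy⁺ n (suc t) s a n≤K (right (1 + t) s (right t (1 + s) q₀))) (copy⁺ n t (1 + s) a n≤K (right t (1 + s) q₀)) e₁
      (copy⁺ n (suc t) (1 + s) (1 + a) n≤K (right (1 + t) (1 + s) q)) e₂
      (copy⁺ n (suc t) (2 + s) (2 + a) n≤K (cong suc q)) (copy⁺ n t (3 + s) (2 + a) n≤K (left (1 + t) (2 + s) (cong suc q))) e₃
      where
      q₀ : t + suc (suc s) ≡ a + K
      q₀ = suc-injective q

-- Doubling the decided region

cancel : ∀ k {m n m′ n′} → m ≡ k + m′ → n ≡ k + n′ → m ≤ n → m′ ≤ n′
cancel k {m′ = m′} {n′} refl refl p = +-cancelˡ-≤ k m′ n′ p

gap : ∀ {m n} → m < n → ∃ λ o → suc o + m ≡ n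
gap {m} {n} p = n ∸ suc m , trans (sym (+-suc (n ∸ suc m) m)) (m∸n+n≡m p)

-- The pairing of `even-pairs`, in the form that decides the fate of an axis cell. That `a` is off
-- in the empty case is what `edge` refutes in the last column.
even-pairs-status : ∀ a r b c → r ≡ a ⊎ r ≡ false →
  2 ≤ cnt a r a b b c false c ⊎ (cnt a r a b b c false c ≡ 0 × a ≡ false)
even-pairs-status true r b c _ = inj₁ (s≤s (≤-trans (s≤s z≤n) (m≤n+m _ ⟦ r ⟧)))
even-pairs-status false r true c (inj₁ refl) = inj₁ (s≤s (s≤s z≤n))
even-pairs-status false r true c (inj₂ refl) = inj₁ (s≤s (s≤s z≤n))
even-pairs-status false r false true (inj₁ refl) = inj₁ (s≤s (s≤s z≤n))
even-pairs-status false r false true (inj₂ refl) = inj₁ (s≤s (s≤s z≤n))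
even-pairs-status false r false false (inj₁ refl) = inj₂ (refl , refl)
even-pairs-status false r false false (inj₂ refl) = inj₂ (refl , refl)

∧-true : ∀ {b c} → b ≡ true → c ≡ true → b ∧ c ≡ true
∧-true refl refl = refl

not-true : ∀ {b} → b ≡ false → not b ≡ true
not-true refl = refl

around-two : ∀ f x d → f x d ≡ true → f x (1 + d) ≡ true → 2 ≤ around f x d
around-two f x d p q with f x d | f x (1 + d)
around-two f x d refl refl | true | true = s≤s (s≤s z≤n)

around-two′ : ∀ f x d → f x d ≡ true → f (1 + x) (1 + d) ≡ true → 2 ≤ around f x d
around-two′ f x d p q with f x d | f (1 + x) (1 + d)
around-two′ f x d refl refl | true | true =
  s≤s (≤-trans (≤-trans (s≤s z≤n) (m≤n+m _ ⟦ f x (2 + d) ⟧)) (m≤n+m _ ⟦ f x (1 + d) ⟧))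

aroundW-two : ∀ f t s → f (2 + t) s ≡ true → f (1 + t) (1 + s) ≡ true → 2 ≤ aroundW f t s
aroundW-two f t s p q with f (2 + t) s | f (1 + t) (1 + s)
aroundW-two f t s refl refl | true | true = s≤s (s≤s z≤n)

-- M = 2^k - 1 and L = M + 1.  The on cells of edge and corner are next to the
-- cells (L , 0) and (L , 1 - M), which they keep dead: the former lies on the
-- axis, and a copy of the latter loses its neighbour (M , - M) to the dead wall.
record Level (M : ℕ) : Set where
  field
    odd-M : odd M ≡ true
    octant : Settled 0 (suc M)
    gamma : Settled 1 M
    edge : ∀ s → suc s ≡ M → W 0 (suc M) 1 s ≡ true
    corner : ∀ t → t + 3 ≡ M → W 0 (suc M) (suc t) 2 ≡ true

module Step (M : ℕ) (level : Level M) where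
  open Level level

  L : ℕ
  L = suc M

  even : odd L ≡ false
  even = trans (odd-suc M) (cong not odd-M)

  module E = Wedge 0 L even octant
  module G = Wedge 1 M even gamma

  -- The half plane for `x` from 1 to `L` and down to `y = - M`, region by region: upper octant,
  -- axis, antidiagonal, mirrored octant, lower wedge. On the two lines beside the antidiagonal, an
  -- off cell has two live neighbours, one on the antidiagonal and the preceding one on its own
  -- line.
  H-status : ∀ a d → suc a ≤ L → 2 + d ≤ a + L → Status (H L (1 + a) (2 + d)) (around (H L) a d) (suc a < L)
  H-status a d a<L d≤ with <-cmp (2 + d) (1 + a)
  ... | tri< lt _ _ with gap lt
  ...   | t , e = Status-subst (sym (H-upper L t (2 + d) (1 + a) e)) (sym (H-upper-around L t d a e)) (subst (_< L) e)
                    (octant t d (subst (_≤ L) (sym e) a<L))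
  H-status a d a<L d≤ | tri≈ _ refl _
    with even-pairs-status (W 0 L 1 d) (H L (1 + d) (1 + d)) (W 0 L 1 (1 + d)) (W 0 L 1 (2 + d)) (H-axis-start L d)
  ... | inj₁ two = inj₂ (inj₁ (subst (2 ≤_) (sym (H-axis-around L d)) two))
  ... | inj₂ (none , off) with m≤n⇒m<n∨m≡n a<L
  ...   | inj₁ lt = inj₂ (inj₂ (trans (H-axis-around L d) none , lt))
  -- In column `L` an axis cell must not be merely unreached; its neighbour `(M , 1)` is on by
  -- `edge`.
  ...   | inj₂ eq = contradiction (trans (sym off) (edge d (suc-injective eq))) λ ()
  H-status a d a<L d≤ | tri> _ _ gt with gap gt
  ... | t , e with <-cmp (suc t) (suc a)
  ...   | tri≈ _ refl _ = inj₁ (trans (cong (H L (1 + a)) (trans (sym e) (sym (dbl≡+ (suc a)))))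
                            (trans (H-antidiagonal L (suc a)) (<ᵇ-true (cancel a {m′ = 2 + a} (trans (sym e) (solve (a ∷ []))) refl d≤))))
  ...   | tri< lt _ _ with gap lt
  ...     | suc s , f = Status-subst (sym (H-lower L t (2 + s) (1 + a) (2 + d) f′ e)) (sym (H-lower-around L t s a d f′ e′)) (subst (_< L) f′)
                          (octant t s (subst (_≤ L) (sym f′) a<L))
    where
    f′ : suc t + (2 + s) ≡ suc a
    f′ = trans (+-comm (suc t) (2 + s)) f
    e′ : t + a ≡ d
    e′ = suc-injective (trans (sym (+-suc t a)) (suc-injective e))
  ...     | zero , refl with odd t in parity
  ...       | true = inj₁ (trans (cong (H L (2 + t)) e′) (trans (H-above-antidiagonal L (suc t)) (∧-true parity (<ᵇ-true below-L))))
    where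
    e′ : 2 + d ≡ 1 + dbl (suc t)
    e′ = trans (sym e) (trans (+-suc (suc t) (suc t)) (cong suc (sym (dbl≡+ (suc t)))))
    below-L : 2 + t < L
    below-L with m≤n⇒m<n∨m≡n a<L
    ... | inj₁ lt = lt
    ... | inj₂ eq = contradiction (trans (sym parity) (trans (cong odd eq) even)) λ ()
  ...       | false = inj₂ (inj₁ (around-two (H L) (1 + t) d
      (trans (cong (H L (1 + t)) e′) (trans (H-above-antidiagonal L t) (∧-true (trans (odd-suc t) (not-true parity)) (<ᵇ-true a<L))))
      (trans (cong (H L (1 + t)) (cong suc e′)) (trans (H-antidiagonal L (suc t)) (<ᵇ-true a<L)))))
    where
    e′ : d ≡ 1 + dbl t
    e′ = suc-injective (suc-injective (trans (sym e) (trans (+-suc (suc t) (suc t)) (cong suc (sym (dbl≡+ (suc t)))))))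
  H-status a d a<L d≤ | tri> _ _ gt | t , e | tri> _ _ gt′ with gap gt′
  ... | g , f = below g (trans (sym e) (trans (cong (_+ suc a) (sym f)) (trans (+-assoc (suc g) (suc a) (suc a)) (cong (_+_ (suc g)) (sym (dbl≡+ (suc a)))))))
    where
    below : ∀ g → 2 + d ≡ suc g + dbl (suc a) → Status (H L (1 + a) (2 + d)) (around (H L) a d) (suc a < L)
    below zero e with odd (suc a) in parity
    ... | true = inj₁ (trans (cong (H L (1 + a)) e) (trans (H-below-antidiagonal L (suc a)) (∧-true parity (<ᵇ-true bound))))
      where
      bound : 2 + a < L
      bound = cancel a {m′ = 3 + a} (trans e (trans (cong suc (dbl≡+ (suc a))) (solve (a ∷ [])))) refl d≤
    ... | false = inj₂ (inj₁ (around-two′ (H L) a d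
        (trans (cong (H L a) e′) (trans (H-below-antidiagonal L a) (∧-true odd-a (<ᵇ-true bound))))
        (trans (cong (H L (1 + a)) (cong suc e′)) (trans (H-antidiagonal L (suc a)) (<ᵇ-true bound)))))
      where
      e′ : d ≡ 1 + dbl a
      e′ = suc-injective (suc-injective e)
      bound : 1 + a < L
      bound = ≤-trans (n≤1+n _) (cancel a {m′ = 3 + a} (trans e (trans (cong suc (dbl≡+ (suc a))) (solve (a ∷ [])))) refl d≤)
      odd-a : odd a ≡ true
      odd-a with odd a | trans (sym (odd-suc a)) parity
      ... | true | _ = refl
    -- The lower wedge was decided one stage earlier, at `M`; `settled-later` carries this forward
    -- to `L`.
    below (suc g) e = Status-subst (sym (H-gamma L (suc a) (2 + g) (2 + d) (sym e)))
      (sym (trans (cong (around (H L) a) e′) (H-gamma-around L a g))) (λ _ → s≤s (≤-trans (m≤m+n (suc a) (2 + g)) bound))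
      (G.settled-later 1 a g bound)
      where
      e′ : d ≡ 2 + g + dbl a
      e′ = suc-injective (suc-injective (trans e (cong (_+_ 2) (trans (+-suc g (suc (dbl a))) (cong suc (+-suc g (dbl a)))))))
      bound : suc a + (2 + g) ≤ M
      bound = cancel (suc a) (trans e (trans (cong (_+_ (2 + g)) (dbl≡+ (suc a))) (solve (a ∷ g ∷ [])))) (+-suc a M) d≤

  H-floor : ∀ a → a ≢ M → H L a (a + M) ≡ false
  H-floor a a≢M with <-cmp a M
  ... | tri≈ _ eq _ = contradiction eq a≢M
  ... | tri> _ _ gt = H-reach-x L a (a + M) gt
  ... | tri< lt _ _ with gap lt
  ...   | e , q = trans (H-gamma L a (suc e) (a + M) q′) (G.wall 1 a e (trans (+-comm a (suc e)) q))
    where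
    q′ : suc e + dbl a ≡ a + M
    q′ = trans (cong (_+_ (suc e)) (dbl≡+ a)) (trans (sym (+-assoc (suc e) a a)) (trans (cong (_+ a) q) (+-comm M a)))

  -- The cell `(M , 2 - M)`: the mirror image of `corner`, or for `M = 1` the diagonal cell
  -- `(1 , 1)`.
  H-corner : ∀ m → suc m ≡ M → H L (suc m) (dbl m) ≡ true
  H-corner zero refl = refl
  H-corner (suc zero) refl = contradiction odd-M λ ()
  H-corner (suc (suc t)) eq = trans (H-lower L t 2 (3 + t) (dbl (2 + t)) (+-comm (suc t) 2)
      (trans (+-suc (1 + t) (2 + t)) (sym (dbl≡+ (2 + t)))))
    (corner t (trans (+-comm t 3) eq))

  octant-next : Settled 0 (L + L)
  octant-next t s q with <-≤-connex L (suc t + (2 + s))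
  ... | inj₂ le = Status-subst refl refl (λ lt → <-≤-trans lt (m≤m+n L L)) (E.settled-later L t s le)
  ... | inj₁ lt with gap lt
  ...   | a , e = Status-subst (sym (E.copy L (suc t) (2 + s) (suc a) ≤-refl (sym e))) (sym (E.copy-around L t s a ≤-refl (sym e)))
                    (λ p → subst (_< L + L) e (+-monoˡ-< L p))
                    (H-status a s (+-cancelʳ-≤ L (suc a) L (subst (_≤ L + L) (sym e) q))
                      (≤-trans (m≤n+m (2 + s) t) (≤-reflexive (suc-injective (sym e)))))

  -- The stage is `suc M + M`, one past the range of `copy`, and the image of `(M , - M)` is missing
  -- on the old wall. Beside the wall three cells have it as neighbour: two are already on, and the
  -- third has two other live neighbours. Elsewhere `H-floor` makes the copy agree with the wall.
  gamma-next : Settled 1 (L + M)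
  gamma-next t s q with <-≤-connex M (suc t + (2 + s))
  ... | inj₂ le = Status-subst refl refl (λ lt → <-≤-trans lt (m≤n+m M L)) (G.settled-later L t s le)
  ... | inj₁ lt with gap lt
  ...   | a , e = new t q e
    where
    module _ (t : ℕ) (q : suc t + (2 + s) ≤ L + M) (e : suc a + M ≡ suc t + (2 + s)) where
      a<L : suc a ≤ L
      a<L = +-cancelʳ-≤ M (suc a) L (subst (_≤ L + M) (sym e) q)
      s≤ : 2 + s ≤ a + L
      s≤ = subst (2 + s ≤_) (trans (sym e) (sym (+-suc a M))) (m≤n+m (2 + s) (suc t))
      transport : aroundW (W 1 (L + M)) t s ≡ around (H L) a s →
        Status (W 1 (L + M) (suc t) (2 + s)) (aroundW (W 1 (L + M)) t s) (suc t + (2 + s) < L + M)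
      transport same = Status-subst (sym (G.copy⁺ L t (2 + s) (suc a) ≤-refl (sym e))) (sym same)
        (λ p → subst (_< L + M) e (+-monoˡ-< M p)) (H-status a s a<L s≤)
    new : ∀ t → suc t + (2 + s) ≤ L + M → suc a + M ≡ suc t + (2 + s) →
      Status (W 1 (L + M) (suc t) (2 + s)) (aroundW (W 1 (L + M)) t s) (suc t + (2 + s) < L + M)
    new (suc t) q e = transport (suc t) q e (G.copy-around-near L (suc t) s a ≤-refl (sym e)
      (G.copy⁺ L t (2 + s) a ≤-refl (suc-injective (sym e))) (G.copy⁺ L t (3 + s) (1 + a) ≤-refl (left (suc t) (2 + s) (sym e)))
      (G.copy⁺ L t (4 + s) (2 + a) ≤-refl (left (suc t) (3 + s) (left (2 + t) (2 + s) (cong suc (sym e))))))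
    new zero q e with <-cmp (suc (suc a)) M
    ... | tri< lt _ _ = transport 0 q e (G.copy-around-near L 0 s a ≤-refl (sym e)
        (sym (trans (cong (H L a) (suc-injective (sym e))) (H-floor a (<⇒≢ (≤-trans (n≤1+n _) (≤-trans (n≤1+n _) lt))))))
        (sym (trans (cong (H L (1 + a)) (sym e)) (H-floor (suc a) (<⇒≢ (≤-trans (n≤1+n _) lt)))))
        (sym (trans (cong (H L (2 + a)) (cong suc (sym e))) (H-floor (suc (suc a)) (<⇒≢ lt)))))
    ... | tri≈ _ eq _ = inj₁ (trans (G.copy⁺ L 0 (2 + s) (suc a) ≤-refl (sym e)) (trans (cong (H L (suc a)) d≡)
        (trans (H-antidiagonal L (suc a)) (<ᵇ-true (≤-trans (≤-reflexive eq) (n≤1+n M))))))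
      where
      d≡ : 2 + s ≡ dbl (suc a)
      d≡ = trans (suc-injective (sym e)) (trans (cong (_+_ a) (sym eq)) (trans (+-suc a (suc a)) (sym (dbl≡+ (suc a)))))
    ... | tri> _ _ gt with m≤n⇒m<n∨m≡n (s≤s⁻¹ gt)
    ...   | inj₂ eq = inj₁ (trans (G.copy⁺ L 0 (2 + s) (suc a) ≤-refl (sym e)) (trans (cong (H L (suc a)) d≡)
        (trans (H-above-antidiagonal L a) (∧-true (trans (cong odd (sym eq)) odd-M) (<ᵇ-true (s≤s (≤-reflexive (sym eq))))))))
      where
      d≡ : 2 + s ≡ suc (dbl a)
      d≡ = trans (suc-injective (sym e)) (trans (cong (_+_ a) eq) (trans (+-suc a a) (cong suc (sym (dbl≡+ a)))))
    ...   | inj₁ lt = inj₂ (inj₁ (two M refl))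
      where
      a≡M : a ≡ M
      a≡M = ≤-antisym (s≤s⁻¹ (a<L 0 q e)) (s≤s⁻¹ lt)
      two : ∀ m → m ≡ M → 2 ≤ aroundW (W 1 (L + M)) 0 s
      two zero eq = contradiction (trans (cong odd eq) odd-M) λ ()
      two (suc m) eq = aroundW-two (W 1 (L + M)) 0 s
        (trans (G.copy⁺ L 1 s M ≤-refl s≡) (trans (cong₂ (H L) (sym eq) s≡dbl) (H-corner m eq)))
        (trans (G.copy⁺ L 0 (1 + s) M ≤-refl s≡) (trans (cong₂ (H L) (sym eq) (cong suc s≡dbl))
          (trans (H-above-antidiagonal L m) (∧-true (trans (cong odd eq) odd-M) (<ᵇ-true (≤-reflexive (cong suc eq)))))))
        where
        s≡ : 2 + s ≡ M + M
        s≡ = trans (suc-injective (sym e)) (cong (_+ M) a≡M)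
        s≡dbl : s ≡ dbl m
        s≡dbl = suc-injective (suc-injective (trans s≡ (trans (cong (λ k → k + k) (sym eq)) (sym (dbl≡+ (suc m))))))

  next : Level (L + M)
  next = record
    { odd-M = trans (odd-suc (M + M)) (not-true (trans (cong odd (sym (dbl≡+ M))) (odd-dbl M)))
    ; octant = subst (Settled 0) (+-suc L M) octant-next
    ; gamma = gamma-next
    -- The cell next to the axis in the new last column is the copy of the antidiagonal tip
    -- `(M , - M)`.
    ; edge = λ s q → subst (λ n → W 0 n 1 s ≡ true) (+-suc L M)
        (trans (E.copy L 1 s M ≤-refl (trans q (+-comm L M)))
          (trans (cong (H L M) (trans (suc-injective q) (sym (dbl≡+ M))))
            (trans (H-antidiagonal L M) (<ᵇ-true (n<1+n M)))))
    -- This is a copy of `(M , M - 2)`: the old corner cell, or for `M = 1` the antidiagonal cell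
    -- `(1 , -1)`.
    ; corner = λ t q → subst (λ n → W 0 n (suc t) 2 ≡ true) (+-suc L M)
        (trans (E.copy L (suc t) 2 M ≤-refl (trans (sym (+-suc t 2)) (trans q (+-comm L M)))) (second M refl))
    }
    where
    odd-dbl : ∀ n → odd (dbl n) ≡ false
    odd-dbl zero = refl
    odd-dbl (suc n) = odd-dbl n
    second : ∀ m → m ≡ M → H L m 2 ≡ true
    second zero eq = contradiction (trans (cong odd eq) odd-M) λ ()
    second (suc zero) eq = trans (H-antidiagonal L 1) (<ᵇ-true (≤-reflexive (cong suc eq)))
    second (suc (suc zero)) eq = contradiction (trans (cong odd eq) odd-M) λ ()
    second (suc (suc (suc t))) eq = trans (H-upper L t 2 (3 + t) (+-comm (suc t) 2)) (corner t (trans (+-comm t 3) eq))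

-- The number `2 ^ suc k - 1`, written in the form in which `Step.next` produces `L + M` from `M`.
mersenne : ℕ → ℕ
mersenne zero = 1
mersenne (suc k) = suc (mersenne k) + mersenne k

level : ∀ k → Level (mersenne k)
-- For `M = 1` the regions contain no cell with `s` at least 2, so everything but `odd-M` and `edge`
-- is vacuous.
level zero = record
  { odd-M = refl
  ; octant = λ t s q → contradiction (≤-trans (m≤n+m (suc (suc s)) t) (s≤s⁻¹ q)) λ { (s≤s ()) }
  ; gamma = λ t s q → contradiction (≤-trans (m≤n+m (suc (suc s)) t) (≤-trans (n≤1+n _) q)) λ { (s≤s ()) }
  ; edge = λ { zero _ → refl }
  ; corner = λ t q → contradiction (trans (sym (+-comm t 3)) q) λ ()
  }
level (suc k) = Step.next (mersenne k) (level k)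

-- Finite sums

sum : ℕ → (ℕ → ℕ) → ℕ
sum zero f = 0
sum (suc n) f = f 0 + sum n (λ i → f (suc i))

sum-cong : ∀ n {f g : ℕ → ℕ} → (∀ i → i < n → f i ≡ g i) → sum n f ≡ sum n g
sum-cong zero e = refl
sum-cong (suc n) e = cong₂ _+_ (e 0 (s≤s z≤n)) (sum-cong n (λ i p → e (suc i) (s≤s p)))

sum-zero : ∀ n {f : ℕ → ℕ} → (∀ i → i < n → f i ≡ 0) → sum n f ≡ 0
sum-zero zero e = refl
sum-zero (suc n) e = cong₂ _+_ (e 0 (s≤s z≤n)) (sum-zero n (λ i p → e (suc i) (s≤s p)))

sum-split : ∀ m n f → sum (m + n) f ≡ sum m f + sum n (λ i → f (m + i))
sum-split zero n f = refl
sum-split (suc m) n f = trans (cong (_+_ (f 0)) (sum-split m n (λ i → f (suc i)))) (sym (+-assoc (f 0) _ _))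

sum-+ : ∀ n f g → sum n (λ i → f i + g i) ≡ sum n f + sum n g
sum-+ zero f g = refl
sum-+ (suc n) f g = trans (cong (_+_ (f 0 + g 0)) (sum-+ n (λ i → f (suc i)) (λ i → g (suc i))))
  (interchange (f 0) (g 0) (sum n (λ i → f (suc i))) (sum n (λ i → g (suc i))))
  where
  interchange : ∀ a b c d → a + b + (c + d) ≡ a + c + (b + d)
  interchange = solve-∀

sum-last : ∀ n f → sum (suc n) f ≡ sum n f + f n
sum-last zero f = +-comm (f 0) 0
sum-last (suc n) f = trans (cong (_+_ (f 0)) (sum-last n (λ i → f (suc i)))) (sym (+-assoc (f 0) _ _))

sum-reverse : ∀ n f → sum n f ≡ sum n (λ i → f (n ∸ suc i))
sum-reverse zero f = refl
sum-reverse (suc n) f = trans (sum-last n f) (trans (+-comm (sum n f) (f n)) (cong (_+_ (f n)) (sum-reverse n f)))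

sum-extend : ∀ {m n} {f : ℕ → ℕ} → m ≤ n → (∀ i → m ≤ i → f i ≡ 0) → sum n f ≡ sum m f
sum-extend {m} {n} {f} m≤n e = trans (cong (λ k → sum k f) (sym (m+[n∸m]≡n m≤n))) (trans (sum-split m (n ∸ m) f)
  (trans (cong (_+_ (sum m f)) (sum-zero (n ∸ m) (λ i _ → e (m + i) (m≤m+n m i)))) (+-identityʳ (sum m f))))

-- The triangle is regrouped by `x + d`. The lower wedge is listed by columns in `rowH` but by
-- `t + s` in `rowW`.
sum-triangle : ∀ n (f : ℕ → ℕ → ℕ) →
  sum n (λ x → sum (n ∸ suc x) (f x)) ≡ sum n (λ y → sum y (λ d → f (y ∸ suc d) d))
sum-triangle zero f = refl
sum-triangle (suc n) f = begin
  sum (suc n) (λ x → sum (n ∸ x) (f x))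
    ≡⟨ sum-last n (λ x → sum (n ∸ x) (f x)) ⟩
  sum n (λ x → sum (n ∸ x) (f x)) + sum (n ∸ n) (f n)
    ≡⟨ cong₂ _+_ (sum-cong n (λ x p → trans (cong (λ k → sum k (f x)) (+-∸-assoc 1 p)) (sum-last (n ∸ suc x) (f x)))) (cong (λ k → sum k (f n)) (n∸n≡0 n)) ⟩
  sum n (λ x → sum (n ∸ suc x) (f x) + f x (n ∸ suc x)) + 0
    ≡⟨ +-identityʳ _ ⟩
  sum n (λ x → sum (n ∸ suc x) (f x) + f x (n ∸ suc x))
    ≡⟨ sum-+ n _ _ ⟩
  sum n (λ x → sum (n ∸ suc x) (f x)) + sum n (λ x → f x (n ∸ suc x))
    ≡⟨ cong₂ _+_ (sum-triangle n f) (trans (sum-reverse n _) (sum-cong n (λ d p → cong (f (n ∸ suc d)) (back d p)))) ⟩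
  sum n (λ y → sum y (λ d → f (y ∸ suc d) d)) + sum n (λ d → f (n ∸ suc d) d)
    ≡⟨ sym (sum-last n (λ y → sum y (λ d → f (y ∸ suc d) d))) ⟩
  sum (suc n) (λ y → sum y (λ d → f (y ∸ suc d) d)) ∎
  where
  open ≡-Reasoning
  back : ∀ d → d < n → n ∸ suc (n ∸ suc d) ≡ d
  back d p = trans (cong (n ∸_) (sym (+-∸-assoc 1 p))) (m∸[m∸n]≡n (<⇒≤ p))

-- Births in the half plane and in the wedges

-- Births are indexed from 0: born… n, row… n and size… n are about stage n + 1.
bornH : ℕ → ℕ → ℕ → ℕ
bornH n x d = ⟦ H (suc n) x d ∧ not (H n x d) ⟧

bornW : ℕ → ℕ → ℕ → ℕ → ℕ
bornW p n t s = ⟦ W p (suc n) t s ∧ not (W p n t s) ⟧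

rowH : ℕ → ℕ → ℕ
rowH n x = sum (n + x) (λ d → bornH n x (suc d))

rowW : ℕ → ℕ → ℕ → ℕ
rowW p n x = sum x (λ d → bornW p n (x ∸ d) (suc d))

sizeH : ℕ → ℕ
sizeH n = sum (suc n) (rowH n)

sizeW : ℕ → ℕ → ℕ
sizeW p n = sum n (rowW p n)

unborn : ∀ {b c} → b ≡ false → ⟦ b ∧ c ⟧ ≡ 0
unborn refl = refl

unchanged : ∀ {b c} → b ≡ c → ⟦ b ∧ not c ⟧ ≡ 0
unchanged {true} refl = refl
unchanged {false} refl = refl

born-cong : ∀ {a a′ b b′} → a ≡ a′ → b ≡ b′ → ⟦ a ∧ not b ⟧ ≡ ⟦ a′ ∧ not b′ ⟧
born-cong refl refl = refl

bornH-reach : ∀ n x d → suc n + x ≤ d → bornH n x d ≡ 0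
bornH-reach n x d p = unborn (H-reach-y (suc n) x d p)

rowH-upper : ∀ n x → sum x (λ d → bornH n (suc x) (suc d)) ≡ rowW 0 n x
rowH-upper n x = sum-cong x λ d p → born-cong (same (suc n) d p) (same n d p)
  where
  same : ∀ n d → d < x → H n (suc x) (suc d) ≡ W 0 n (x ∸ d) (suc d)
  same n d p = trans (H-upper n (x ∸ suc d) (suc d) (suc x) (cong suc (m∸n+n≡m p)))
                     (cong (λ t → W 0 n t (suc d)) (sym (+-∸-assoc 1 p)))

rowH-lower : ∀ n x → sum x (λ j → bornH n (suc x) (suc (suc x + j))) ≡ rowW 0 n x
rowH-lower n x = trans (sum-cong x λ j p → born-cong (same (suc n) j p) (same n j p))
  (trans (sum-reverse x (λ j → bornW 0 n (suc j) (x ∸ j)))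
    (sum-cong x λ d p → cong₂ (bornW 0 n) (sym (+-∸-assoc 1 p)) (back d p)))
  where
  same : ∀ n j → j < x → H n (suc x) (suc (suc x + j)) ≡ W 0 n (suc j) (x ∸ j)
  same n j p = H-lower n j (x ∸ j) (suc x) (suc (suc x + j)) (cong suc (m+[n∸m]≡n (<⇒≤ p)))
                       (cong suc (+-comm j (suc x)))
  back : ∀ d → d < x → x ∸ (x ∸ suc d) ≡ suc d
  back d p = m∸[m∸n]≡n p

rowH-gamma : ∀ n g x → sum g (λ e → bornH n (suc x) (suc (suc x + (x + suc e)))) ≡ sum g (λ e → bornW 1 n (suc x) (suc e))
rowH-gamma n g x = sum-cong g λ e p → born-cong (same (suc n) e) (same n e)
  where
  position : ∀ e → suc e + (suc x + suc x) ≡ suc (suc x + (x + suc e))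
  position e = solve (e ∷ x ∷ [])
  same : ∀ n e → H n (suc x) (suc (suc x + (x + suc e))) ≡ W 1 n (suc x) (suc e)
  same n e = H-gamma n (suc x) (suc e) _ (trans (cong (_+_ (suc e)) (dbl≡+ (suc x))) (position e))

-- The index starts at 2, that is at stage 3, because `(1 , 0)` is born at stage 2.
rowH-axis : ∀ n x → bornH (2 + n) (suc x) (suc x) ≡ 0
rowH-axis n zero = refl
rowH-axis n (suc x) = unborn (H-axis (3 + n) x)

-- Births in column `suc x` of the antidiagonal, and equally of the diagonal.
frontal : ℕ → ℕ → ℕ
frontal n x = ⟦ (suc x <ᵇ suc n) ∧ not (suc x <ᵇ n) ⟧

sum-frontal : ∀ n → sum (suc n) (frontal (suc n)) ≡ 1
sum-frontal n = trans (sum-last n (frontal (suc n))) (cong₂ _+_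
  (sum-zero n λ x p → unchanged (trans (<ᵇ-true (m≤n⇒m≤1+n p)) (sym (<ᵇ-true p))))
  (born-cong (<ᵇ-true (n<1+n n)) (<ᵇ-false (≤-refl {n}))))

-- From top to bottom the column consists of `x` octant cells, the axis cell, `x` mirrored cells,
-- the antidiagonal cell and the cells of the lower wedge.
rowH-split : ∀ n x → x < 2 + n → rowH (2 + n) (suc x) ≡
  2 * rowW 0 (2 + n) x + (frontal (2 + n) x + sum (2 + n ∸ suc x) (λ e → bornW 1 (2 + n) (suc x) (suc e)))
rowH-split n x p = begin
  rowH (2 + n) (suc x)
    ≡⟨ cong (λ k → sum k f) length-split ⟩
  sum (x + (1 + (x + (1 + g)))) f
    ≡⟨ sum-split x (1 + (x + (1 + g))) f ⟩
  sum x f + (f (x + 0) + sum (x + (1 + g)) (λ i → f (x + suc i)))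
    ≡⟨ cong₂ (λ a b → sum x f + (a + b)) axis (trans (sum-cong (x + (1 + g)) (λ i _ → cong f (+-suc x i))) (sum-split x (1 + g) (λ i → f (suc x + i)))) ⟩
  sum x f + (sum x (λ j → f (suc x + j)) + (f (suc x + (x + 0)) + sum g (λ e → f (suc x + (x + suc e)))))
    ≡⟨ cong₂ _+_ (rowH-upper (2 + n) x) (cong₂ _+_ (rowH-lower (2 + n) x) (cong₂ _+_ anti (rowH-gamma (2 + n) g x))) ⟩
  u + (u + (frontal (2 + n) x + sum g (λ e → bornW 1 (2 + n) (suc x) (suc e))))
    ≡⟨ solve-2 u (frontal (2 + n) x + sum g (λ e → bornW 1 (2 + n) (suc x) (suc e))) ⟩
  2 * u + (frontal (2 + n) x + sum g (λ e → bornW 1 (2 + n) (suc x) (suc e))) ∎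
  where
  open ≡-Reasoning
  f : ℕ → ℕ
  f d = bornH (2 + n) (suc x) (suc d)
  g u : ℕ
  g = 2 + n ∸ suc x
  u = rowW 0 (2 + n) x
  solve-2 : ∀ u r → u + (u + r) ≡ 2 * u + r
  solve-2 = solve-∀
  length-split : 2 + n + suc x ≡ x + (1 + (x + (1 + g)))
  length-split = trans (cong (_+ suc x) (sym (m∸n+n≡m p))) (move g x)
    where
    move : ∀ g x → g + suc x + suc x ≡ x + (1 + (x + (1 + g)))
    move = solve-∀
  axis : f (x + 0) ≡ 0
  axis = trans (cong f (+-identityʳ x)) (rowH-axis n x)
  anti : f (suc x + (x + 0)) ≡ frontal (2 + n) x
  anti = trans (cong f position) (born-cong (H-antidiagonal (3 + n) (suc x)) (H-antidiagonal (2 + n) (suc x)))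
    where
    position : suc x + (x + 0) ≡ suc (dbl x)
    position = cong suc (trans (cong (_+_ x) (+-identityʳ x)) (sym (dbl≡+ x)))

rowH-0 : ∀ n → rowH n 0 ≡ 0
rowH-0 n = sum-zero (n + 0) λ _ _ → refl

sum-* : ∀ n c f → sum n (λ i → c * f i) ≡ c * sum n f
sum-* zero c f = sym (*-zeroʳ c)
sum-* (suc n) c f = trans (cong (_+_ (c * f 0)) (sum-* n c (λ i → f (suc i)))) (sym (*-distribˡ-+ c (f 0) _))

sizeH-split : ∀ n → sizeH (2 + n) ≡ 2 * sizeW 0 (2 + n) + (1 + sizeW 1 (2 + n))
sizeH-split n = begin
  rowH (2 + n) 0 + sum (2 + n) (λ x → rowH (2 + n) (suc x))
    ≡⟨ cong₂ _+_ (rowH-0 (2 + n)) (sum-cong (2 + n) (rowH-split n)) ⟩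
  sum (2 + n) (λ x → 2 * rowW 0 (2 + n) x + (frontal (2 + n) x + gammas x))
    ≡⟨ trans (sum-+ (2 + n) (λ x → 2 * rowW 0 (2 + n) x) (λ x → frontal (2 + n) x + gammas x))
         (cong₂ _+_ (sum-* (2 + n) 2 (rowW 0 (2 + n))) (sum-+ (2 + n) (frontal (2 + n)) gammas)) ⟩
  2 * sizeW 0 (2 + n) + (sum (2 + n) (frontal (2 + n)) + sum (2 + n) gammas)
    ≡⟨ cong (_+_ (2 * sizeW 0 (2 + n))) (cong₂ _+_ (sum-frontal (suc n)) (trans (sum-triangle (2 + n) (λ x e → bornW 1 (2 + n) (suc x) (suc e)))
         (sum-cong (2 + n) λ y _ → sum-cong y λ d p → cong (λ t → bornW 1 (2 + n) t (suc d)) (sym (+-∸-assoc 1 p))))) ⟩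
  2 * sizeW 0 (2 + n) + (1 + sizeW 1 (2 + n)) ∎
  where
  open ≡-Reasoning
  gammas : ℕ → ℕ
  gammas x = sum (2 + n ∸ suc x) (λ e → bornW 1 (2 + n) (suc x) (suc e))

module WedgeSize (p k : ℕ) (even : odd (p + suc k) ≡ false) (settled : Settled p (suc k)) where
  open Wedge p (suc k) even settled

  rowW-frozen : ∀ m x → x < k → rowW p (m + suc k) x ≡ 0
  rowW-frozen m x x<k = sum-zero x λ d q → unchanged (trans (frozen (suc m) (x ∸ d) d (bound d q)) (sym (frozen m (x ∸ d) d (bound d q))))
    where
    bound : ∀ d → d < x → x ∸ d + suc d ≤ suc k
    bound d q = subst (_≤ suc k) (sym (trans (+-suc (x ∸ d) d) (cong suc (m∸n+n≡m (<⇒≤ q))))) (≤-trans x<k (n≤1+n k))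

  -- At distance `suc k + j` there are exactly `k + j` cells strictly between the diagonal and the
  -- old wall; this is the room for column `j` of the copy.
  rowW-copy : ∀ n j → n ≤ suc k → rowW p (n + suc k) (k + j) ≡ sum (k + j) (λ d → bornH n j (suc d))
  rowW-copy n j n≤ = sum-cong (k + j) λ d q → born-cong (same (suc n) d (s≤s n≤) q) (same n d (m≤n⇒m≤1+n n≤) q)
    where
    same : ∀ n d → n ≤ suc (suc k) → d < k + j → W p (n + suc k) (k + j ∸ d) (suc d) ≡ H n j (suc d)
    same n d n≤ q = trans (cong (λ t → W p (n + suc k) t (suc d)) (+-∸-assoc 1 q))
      (copy⁺ n (k + j ∸ suc d) (suc d) j n≤ (trans (cong suc (m∸n+n≡m q)) (trans (cong suc (+-comm k j)) (sym (+-suc j k)))))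

  sizeW-copy : ∀ n → n ≤ suc k → sizeW p (n + suc k) ≡ sum (suc n) (λ j → sum (k + j) (λ d → bornH n j (suc d)))
  sizeW-copy n n≤ = trans (cong (λ m → sum m (rowW p (n + suc k))) (trans (+-comm n (suc k)) (sym (+-suc k n))))
    (trans (sum-split k (suc n) (rowW p (n + suc k)))
      (cong₂ _+_ (sum-zero k (rowW-frozen n)) (sum-cong (suc n) λ j _ → rowW-copy n j n≤)))

  sizeW-early : ∀ n → n ≤ k → sizeW p (n + suc k) ≡ sizeH n
  sizeW-early n n≤k = trans (sizeW-copy n (m≤n⇒m≤1+n n≤k)) (sum-cong (suc n) λ j _ →
    sum-extend (+-monoˡ-≤ j n≤k) λ d q → bornH-reach n j (suc d) (s≤s q))

  -- At this index the half plane can first reach the row `y = - suc k`, which the copy would lay on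
  -- the old wall. The births in that row are the second summand.
  sizeW-late : sizeW p (suc k + suc k) + sum (suc (suc k)) (λ j → bornH (suc k) j (suc (k + j))) ≡ sizeH (suc k)
  sizeW-late = trans (cong (_+ sum (suc (suc k)) lost) (sizeW-copy (suc k) ≤-refl))
    (trans (sym (sum-+ (suc (suc k)) (λ j → sum (k + j) (λ d → bornH (suc k) j (suc d))) lost)) (sum-cong (suc (suc k)) λ j _ → sym (sum-last (k + j) (λ d → bornH (suc k) j (suc d)))))
    where
    lost : ℕ → ℕ
    lost j = bornH (suc k) j (suc (k + j))

octant-size : ∀ M → Level M → ∀ n → n ≤ M → sizeW 0 (n + suc M) ≡ sizeH n
octant-size M level = WedgeSize.sizeW-early 0 M (Step.even M level) (Level.octant level)

gamma-size : ∀ k → Level (suc k) → ∀ n → n ≤ k → sizeW 1 (n + suc k) ≡ sizeH n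
gamma-size k level = WedgeSize.sizeW-early 1 k (Step.even (suc k) level) (Level.gamma level)

-- The lost cell is the copy of (M , - M), which would lie on the dead wall.
gamma-size-last : ∀ k → Level (suc k) → sizeW 1 (suc k + suc k) + 1 ≡ sizeH (suc k)
gamma-size-last k level = trans (cong (_+_ (sizeW 1 (suc k + suc k))) (sym lost)) (WedgeSize.sizeW-late 1 k (Step.even (suc k) level) (Level.gamma level))
  where
  M : ℕ
  M = suc k
  lost : sum (suc M) (λ j → bornH M j (M + j)) ≡ 1
  lost = trans (sum-last M (λ j → bornH M j (M + j))) (cong₂ _+_
    (sum-zero M λ j p → unborn {c = not (H M j (M + j))} (trans (cong (H (suc M) j) (+-comm M j)) (Step.H-floor M level j (<⇒≢ p))))
    (born-cong (trans (cong (H (suc M) M) (sym (dbl≡+ M))) (trans (H-antidiagonal (suc M) M) (<ᵇ-true (n<1+n M))))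
      (H-reach-x M M (M + M) ≤-refl)))

-- Index `n + suc M` is `n` steps into the copy in the octant but `suc n` steps into that in the
-- lower wedge, whose wall comes one stage earlier. The 1 is the antidiagonal.
sizeH-early : ∀ M → Level M → ∀ n → suc n < M → sizeH (n + suc M) ≡ 2 * sizeH n + (1 + sizeH (suc n))
sizeH-early (suc k) level n n<k = trans (cong sizeH (+-comm n (2 + k))) (trans (sizeH-split (k + n))
  (cong₂ (λ a b → 2 * a + (1 + b))
    (trans (cong (sizeW 0) (+-comm (2 + k) n)) (octant-size (suc k) level n (≤-trans (n≤1+n n) (≤-trans (n≤1+n _) n<k))))
    (trans (cong (sizeW 1) (cong suc (+-comm (suc k) n))) (gamma-size k level (suc n) (s≤s⁻¹ n<k)))))

-- The birth on the antidiagonal is cancelled by the cell that the lower wedge loses to its wall.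
sizeH-late : ∀ k → Level (suc k) → sizeH (k + (2 + k)) ≡ 2 * sizeH k + sizeH (suc k)
sizeH-late k level = trans (cong sizeH (+-comm k (2 + k))) (trans (sizeH-split (k + k))
  (cong₂ (λ a b → 2 * a + b)
    (trans (cong (sizeW 0) (+-comm (2 + k) k)) (octant-size (suc k) level k (n≤1+n k)))
    (trans (+-comm 1 _) (trans (cong (λ m → sizeW 1 m + 1) (cong suc (sym (+-suc k k)))) (gamma-size-last k level)))))

-- The lower wedge has arrived at the wall of the next level and begins a new copy, whose `sizeH 0`
-- is 0.
sizeH-last : ∀ M → Level M → sizeH (M + suc M) ≡ 2 * sizeH M + 1
sizeH-last (suc k) level = trans (cong sizeH (+-comm (suc k) (2 + k))) (trans (sizeH-split (k + suc k))
  (cong₂ (λ a b → 2 * a + (1 + b))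
    (trans (cong (sizeW 0) (+-comm (2 + k) (suc k))) (octant-size (suc k) level (suc k) ≤-refl))
    (gamma-size (suc k + suc k) (Step.next (suc k) level) 0 z≤n)))

-- The grid automata seen from a diagonal

-- The neighbours are listed in the order of around, with y = x - d.
cntℤ : (ℤ → ℤ → Bool) → ℤ → ℤ → ℕ
cntℤ f i j = cnt
  (f (i ℤ.+ ℤ.-1ℤ) (j ℤ.+ ℤ.1ℤ)) (f (i ℤ.+ ℤ.-1ℤ) j) (f (i ℤ.+ ℤ.-1ℤ) (j ℤ.+ ℤ.-1ℤ))
  (f i (j ℤ.+ ℤ.1ℤ)) (f i (j ℤ.+ ℤ.-1ℤ))
  (f (i ℤ.+ ℤ.1ℤ) (j ℤ.+ ℤ.1ℤ)) (f (i ℤ.+ ℤ.1ℤ) j) (f (i ℤ.+ ℤ.1ℤ) (j ℤ.+ ℤ.-1ℤ))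

cntℤ-mono : ∀ {f g} → (∀ i j → ⟦ f i j ⟧ ≤ ⟦ g i j ⟧) → ∀ i j → cntℤ f i j ≤ cntℤ g i j
cntℤ-mono le i j = cnt-mono (le _ _) (le _ _) (le _ _) (le _ _) (le _ _) (le _ _) (le _ _) (le _ _)

sum-countTrue : ∀ a b c d e f g h → countTrue (a ∷ b ∷ c ∷ d ∷ e ∷ f ∷ g ∷ h ∷ []) ≡ cnt a b c d e f g h
sum-countTrue a b c d e f g h =
  trans (head a _) (cong (_+_ ⟦ a ⟧) (trans (head b _) (cong (_+_ ⟦ b ⟧) (trans (head c _) (cong (_+_ ⟦ c ⟧)
  (trans (head d _) (cong (_+_ ⟦ d ⟧) (trans (head e _) (cong (_+_ ⟦ e ⟧) (trans (head f _) (cong (_+_ ⟦ f ⟧)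
  (trans (head g _) (cong (_+_ ⟦ g ⟧) (trans (head h []) (+-identityʳ ⟦ h ⟧)))))))))))))))
  where
  head : ∀ b bs → countTrue (b ∷ bs) ≡ ⟦ b ⟧ + countTrue bs
  head true bs = refl
  head false bs = refl

Commutes : (ℤ → ℤ) → Set
Commutes u = ∀ i e → u i ℤ.+ e ≡ u (i ℤ.+ e)

commutes-id : Commutes (λ i → i)
commutes-id i e = refl

commutes-1+ : Commutes (ℤ._+_ ℤ.1ℤ)
commutes-1+ i e = ℤₚ.+-assoc ℤ.1ℤ i e

-- The maps `u` and `v` are the identity or a shift by 1; they move the seed of each sector to the
-- origin.
frame : ∀ {u v} → Commutes u → Commutes v → ∀ (f : Cell → Bool) i j →
  countTrue (map f (neighbours (u i , v j))) ≡ cntℤ (λ i j → f (u i , v j)) i j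
frame {u} {v} U V f i j = trans (sum-countTrue
     (f (u i ℤ.+ ℤ.-1ℤ , v j ℤ.+ ℤ.-1ℤ)) (f (u i ℤ.+ ℤ.-1ℤ , v j)) (f (u i ℤ.+ ℤ.-1ℤ , v j ℤ.+ ℤ.1ℤ))
     (f (u i , v j ℤ.+ ℤ.-1ℤ)) (f (u i , v j ℤ.+ ℤ.1ℤ))
     (f (u i ℤ.+ ℤ.1ℤ , v j ℤ.+ ℤ.-1ℤ)) (f (u i ℤ.+ ℤ.1ℤ , v j)) (f (u i ℤ.+ ℤ.1ℤ , v j ℤ.+ ℤ.1ℤ))) (trans
  (cnt-reflect (f (u i ℤ.+ ℤ.-1ℤ , v j ℤ.+ ℤ.1ℤ)) (f (u i ℤ.+ ℤ.-1ℤ , v j)) (f (u i ℤ.+ ℤ.-1ℤ , v j ℤ.+ ℤ.-1ℤ))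
     (f (u i , v j ℤ.+ ℤ.1ℤ)) (f (u i , v j ℤ.+ ℤ.-1ℤ))
     (f (u i ℤ.+ ℤ.1ℤ , v j ℤ.+ ℤ.1ℤ)) (f (u i ℤ.+ ℤ.1ℤ , v j)) (f (u i ℤ.+ ℤ.1ℤ , v j ℤ.+ ℤ.-1ℤ)))
  (cnt-cong (eq (U _ _) (V _ _)) (eq (U _ _) refl) (eq (U _ _) (V _ _)) (eq refl (V _ _)) (eq refl (V _ _))
    (eq (U _ _) (V _ _)) (eq (U _ _) refl) (eq (U _ _) (V _ _))))
  where
  eq : ∀ {a a′ b b′} → a ≡ a′ → b ≡ b′ → f (a , b) ≡ f (a′ , b′)
  eq refl refl = refl

cnt-transpose : ∀ a b c d e f g h → cnt a b c d e f g h ≡ cnt h e c g b f d a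
cnt-transpose a b c d e f g h = sums ⟦ a ⟧ ⟦ b ⟧ ⟦ c ⟧ ⟦ d ⟧ ⟦ e ⟧ ⟦ f ⟧ ⟦ g ⟧ ⟦ h ⟧
  where
  sums : ∀ a b c d e f g h →
    a + (b + (c + (d + (e + (f + (g + h)))))) ≡ h + (e + (c + (g + (b + (f + (d + a))))))
  sums = solve-∀

cntℤ-transpose : ∀ f i j → cntℤ f i j ≡ cntℤ (λ i j → f j i) j i
cntℤ-transpose f i j = cnt-transpose
  (f (i ℤ.+ ℤ.-1ℤ) (j ℤ.+ ℤ.1ℤ)) (f (i ℤ.+ ℤ.-1ℤ) j) (f (i ℤ.+ ℤ.-1ℤ) (j ℤ.+ ℤ.-1ℤ))
  (f i (j ℤ.+ ℤ.1ℤ)) (f i (j ℤ.+ ℤ.-1ℤ))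
  (f (i ℤ.+ ℤ.1ℤ) (j ℤ.+ ℤ.1ℤ)) (f (i ℤ.+ ℤ.1ℤ) j) (f (i ℤ.+ ℤ.1ℤ) (j ℤ.+ ℤ.-1ℤ))

==ᶜ-sound : ∀ c s → (c ==ᶜ s) ≡ true → c ≡ s
==ᶜ-sound (i , j) (k , l) e with i ℤₚ.≟ k | j ℤₚ.≟ l
... | yes refl | yes refl = refl

on-blocked : ∀ s a n c → a c ≡ false → c ≢ s → on s a n c ≡ false
on-blocked s a zero c blocked c≢s = refl
on-blocked s a (suc zero) c blocked c≢s with c ==ᶜ s in e
... | true = contradiction (==ᶜ-sound c s e) c≢s
... | false = refl
on-blocked s a (suc (suc n)) c blocked c≢s rewrite on-blocked s a (suc n) c blocked c≢s | blocked = refl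

-- A potential that drops by at most 1 from a cell to a neighbour limits the speed of growth. It is
-- applied to the absolute value of either coordinate.
on-reach : (p : Cell → ℕ) → (∀ c → All (λ c′ → p c ≤ suc (p c′)) (neighbours c)) →
  ∀ s a n c → n + p s ≤ p c → on s a n c ≡ false
on-reach p lip s a zero c far = refl
on-reach p lip s a (suc zero) c far with c ==ᶜ s in e
... | true = contradiction (subst (λ c → suc (p s) ≤ p c) (==ᶜ-sound c s e) far) (<-irrefl refl)
... | false = refl
on-reach p lip s a (suc (suc n)) c far = trans
  (cong₂ (λ b k → b ∨ (a c ∧ isOne k)) (on-reach p lip s a (suc n) c (≤-trans (n≤1+n _) far)) 
    (none (neighbours c) (All.map (λ {c′} l → on-reach p lip s a (suc n) c′ (s≤s⁻¹ (≤-trans far l))) (lip c))))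
  (∧-zeroʳ (a c))
  where
  none : ∀ cs → All (λ c′ → on s a (suc n) c′ ≡ false) cs → countTrue (map (on s a (suc n)) cs) ≡ 0
  none [] All.[] = refl
  none (c′ ∷ cs) (l All.∷ ls) rewrite l = none cs ls

∣∣-pred : ∀ i → ∣ i ∣ ≤ suc ∣ i ℤ.+ ℤ.-1ℤ ∣
∣∣-pred (+ zero) = z≤n
∣∣-pred (+ suc x) = ≤-refl
∣∣-pred -[1+ x ] = s≤s (≤-trans (≤-trans (m≤m+n x 0) (n≤1+n _)) (n≤1+n _))

∣∣-suc : ∀ i → ∣ i ∣ ≤ suc ∣ i ℤ.+ ℤ.1ℤ ∣
∣∣-suc (+ x) = ≤-trans (m≤m+n x 1) (n≤1+n _)
∣∣-suc -[1+ zero ] = ≤-refl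
∣∣-suc -[1+ suc x ] = ≤-refl

on-reach-x : ∀ s a n i j → n + ∣ proj₁ s ∣ ≤ ∣ i ∣ → on s a n (i , j) ≡ false
on-reach-x s a n i j = on-reach (λ c → ∣ proj₁ c ∣)
  (λ (i , j) → ∣∣-pred i All.∷ ∣∣-pred i All.∷ ∣∣-pred i All.∷ n≤1+n _ All.∷ n≤1+n _ All.∷ ∣∣-suc i All.∷ ∣∣-suc i All.∷ ∣∣-suc i All.∷ All.[]) s a n (i , j)

on-reach-y : ∀ s a n i j → n + ∣ proj₂ s ∣ ≤ ∣ j ∣ → on s a n (i , j) ≡ false
on-reach-y s a n i j = on-reach (λ c → ∣ proj₂ c ∣)
  (λ (i , j) → ∣∣-pred j All.∷ n≤1+n _ All.∷ ∣∣-suc j All.∷ ∣∣-pred j All.∷ ∣∣-suc j All.∷ ∣∣-pred j All.∷ n≤1+n _ All.∷ ∣∣-suc j All.∷ All.[]) s a n (i , j)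

-- An automaton seen from its diagonal: what happens in the sector x ≥ 0, y ≤ x
-- when nothing behind the diagonal can arrive before the front x = n.
record Sector : Set where
  field
    B : ℕ → ℤ → ℤ → Bool
    allowed : ℤ → ℤ → Bool
    step : ∀ n i j → B (2 + n) i j ≡ B (1 + n) i j ∨ (allowed i j ∧ isOne (cntℤ (B (1 + n)) i j))
    open-right : ∀ x j → allowed (+ suc x) j ≡ true
    reach-x : ∀ n x j → n ≤ x → B n (+ x) j ≡ false
    reach-y : ∀ n i y → n ≤ y → B n i (+ y) ≡ false
    seed : B 1 (+ 0) (+ 0) ≡ true
    south : B 1 (+ 0) ℤ.-1ℤ ≡ false

suc⊖suc : ∀ m n → suc m ⊖ suc n ≡ m ⊖ n
suc⊖suc = ℤₚ.[1+m]⊖[1+n]≡m⊖n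

⊖+1 : ∀ m n → (m ⊖ n) ℤ.+ ℤ.1ℤ ≡ suc m ⊖ n
⊖+1 m n = trans (ℤₚ.distribˡ-⊖-+-pos 1 m n) (cong (_⊖ n) (+-comm m 1))

⊖-1 : ∀ m n → (m ⊖ n) ℤ.+ ℤ.-1ℤ ≡ m ⊖ suc n
⊖-1 m n = trans (ℤₚ.distribˡ-⊖-+-neg 0 m n) (cong (m ⊖_) (+-identityʳ (suc n)))

module SectorProperties (S : Sector) where
  open Sector S

  step-right : ∀ n x j → B (2 + n) (+ suc x) j ≡ B (1 + n) (+ suc x) j ∨ isOne (cntℤ (B (1 + n)) (+ suc x) j)
  step-right n x j = trans (step n (+ suc x) j)
    (cong (λ b → B (1 + n) (+ suc x) j ∨ (b ∧ isOne (cntℤ (B (1 + n)) (+ suc x) j))) (open-right x j))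

  B-mono : ∀ n i j → ⟦ B (1 + n) i j ⟧ ≤ ⟦ B (2 + n) i j ⟧
  B-mono n i j = subst (λ b → ⟦ B (1 + n) i j ⟧ ≤ ⟦ b ⟧) (sym (step n i j)) (∨-mono (B (1 + n) i j) _)

  -- On arrival at `(x + 1 , x + 1)` everything above is excluded by `reach-y` and everything to the
  -- right by `reach-x`, so `(x , x)` is the only live neighbour.
  diagonal : ∀ n x → B n (+ x) (+ x) ≡ (x <ᵇ n)
  diagonal zero x = reach-x 0 x (+ x) z≤n
  diagonal (suc n) zero = always n
    where
    always : ∀ n → B (suc n) (+ 0) (+ 0) ≡ true
    always zero = seed
    always (suc n) = ⟦⟧-true (B-mono n (+ 0) (+ 0)) (always n)
  diagonal (suc n) (suc x) = front (λ n → B (suc n) (+ suc x) (+ suc x)) (λ n → cntℤ (B (suc n)) (+ suc x) (+ suc x)) false x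
    (λ n → step-right n x (+ suc x)) (λ n p → reach-x (suc n) (suc x) _ (s≤s p))
    (cnt-cong (reach-y (suc x) _ (suc x + 1) (m≤m+n _ 1)) (reach-y (suc x) _ (suc x) ≤-refl)
      (trans (diagonal (suc x) x) (<ᵇ-true (n<1+n x)))
      (reach-x (suc x) (suc x) _ ≤-refl) (reach-x (suc x) (suc x) _ ≤-refl)
      (reach-x (suc x) (suc x + 1) _ (m≤m+n _ 1)) (reach-x (suc x) (suc x + 1) _ (m≤m+n _ 1)) (reach-x (suc x) (suc x + 1) _ (m≤m+n _ 1)))
    (λ n → cntℤ-mono (B-mono n) (+ suc x) (+ suc x)) n

  -- On arrival at `(x + 1 , x)` the live neighbours are `(x , x)` and possibly `(x , x - 1)`, so
  -- the line alternates, starting from the off cell of `south`.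
  below-diagonal : ∀ n x → B n (+ suc x) (+ x) ≡ odd (suc x) ∧ (suc x <ᵇ n)
  below-diagonal zero x = trans (reach-x 0 (suc x) (+ x) z≤n) (sym (∧-zeroʳ (odd (suc x))))
  below-diagonal (suc n) x = trans
    (front (λ n → B (suc n) (+ suc x) (+ x)) (λ n → cntℤ (B (suc n)) (+ suc x) (+ x)) (odd x) x
      (λ n → step-right n x (+ x)) (λ n p → reach-x (suc n) (suc x) _ (s≤s p))
      (trans (cnt-cong (reach-y (suc x) _ (x + 1) (≤-reflexive (+-comm 1 x)))
          (trans (diagonal (suc x) x) (<ᵇ-true (n<1+n x))) (second x)
          (reach-x (suc x) (suc x) _ ≤-refl) (reach-x (suc x) (suc x) _ ≤-refl)
          (reach-x (suc x) (suc x + 1) _ (m≤m+n _ 1)) (reach-x (suc x) (suc x + 1) _ (m≤m+n _ 1)) (reach-x (suc x) (suc x + 1) _ (m≤m+n _ 1)))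
        (cong suc (+-identityʳ ⟦ odd x ⟧)))
      (λ n → cntℤ-mono (B-mono n) (+ suc x) (+ x)) n)
    (cong (_∧ (x <ᵇ n)) (sym (odd-suc x)))
    where
    second : ∀ x → B (suc x) (+ x) (+ x ℤ.+ ℤ.-1ℤ) ≡ odd x
    second zero = south
    second (suc x) = trans (below-diagonal (2 + x) x) (∧-known (odd (suc x)) (<ᵇ-true (n<1+n x)))

  around-right : ∀ n x d → cntℤ (B n) (+ suc x) (suc x ⊖ (2 + d)) ≡ around (λ x d → B n (+ x) (x ⊖ d)) x d
  around-right n x d = cnt-cong
    (cong (B n (+ x)) (trans up (trans (suc⊖suc (suc x) (suc d)) (suc⊖suc x d))))
    (cong (B n (+ x)) (suc⊖suc x (1 + d)))
    (cong (B n (+ x)) (trans down (suc⊖suc x (2 + d))))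
    (cong (B n (+ suc x)) (trans up (suc⊖suc (suc x) (1 + d))))
    (cong (B n (+ suc x)) down)
    (cong₂ (B n) next up)
    (cong₂ (B n) next (sym (suc⊖suc (suc x) (2 + d))))
    (cong₂ (B n) next (trans down (sym (suc⊖suc (suc x) (3 + d)))))
    where
    up : (suc x ⊖ (2 + d)) ℤ.+ ℤ.1ℤ ≡ (2 + x) ⊖ (2 + d)
    up = ⊖+1 (suc x) (2 + d)
    down : (suc x ⊖ (2 + d)) ℤ.+ ℤ.-1ℤ ≡ suc x ⊖ (3 + d)
    down = ⊖-1 (suc x) (2 + d)
    next : + suc x ℤ.+ ℤ.1ℤ ≡ + (2 + x)
    next = cong +_ (+-comm (suc x) 1)

  -- With the diagonal and the line below it known, the remaining cells see nothing beyond the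
  -- diagonal, and the rule is that of `H`.
  sector : (∀ n d → B n (+ 0) -[1+ d ] ≡ false) → ∀ n x d → B n (+ x) (x ⊖ d) ≡ H n x d
  sector wall n x zero = diagonal n x
  sector wall n zero (suc d) = wall n d
  sector wall n (suc x) (suc zero) = below-diagonal n x
  sector wall zero (suc x) (suc (suc d)) = reach-x 0 (suc x) _ z≤n
  sector wall (suc zero) (suc x) (suc (suc d)) = trans (reach-x 1 (suc x) _ (s≤s z≤n)) (sym (H-reach-x 1 (suc x) (2 + d) (s≤s z≤n)))
  sector wall (suc (suc n)) (suc x) (suc (suc d)) = trans (step-right n x _)
    (grow (sector wall (suc n) (suc x) (suc (suc d)))
      (trans (around-right (suc n) x d)
        (cnt-cong (sector wall (suc n) x d) (sector wall (suc n) x (1 + d)) (sector wall (suc n) x (2 + d))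
          (sector wall (suc n) (1 + x) (1 + d)) (sector wall (suc n) (1 + x) (3 + d))
          (sector wall (suc n) (2 + x) (2 + d)) (sector wall (suc n) (2 + x) (3 + d)) (sector wall (suc n) (2 + x) (4 + d)))))

  module _ (mirror : ∀ n i j → B n i (ℤ.- j) ≡ B n i j) where

    reflected : ∀ x d → d ≡ x + x → x ⊖ d ≡ ℤ.- (+ x)
    reflected x d refl = trans (cong (_⊖ (x + x)) (sym (+-identityʳ x))) (trans (ℤₚ.+-cancelˡ-⊖ x 0 x) (ℤₚ.⊖-≤ z≤n))

    -- The full automaton has no dead wall, but the diagonal has a mirror image. The antidiagonal
    -- and the line above it are known by reflection, and every other cell has all its neighbours in
    -- the cone where `y` is at most `x` in absolute value.
    mirrored-step : ∀ n → (∀ x d → d ≤ dbl x → B (suc n) (+ x) (x ⊖ d) ≡ H (suc n) x d) →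
      ∀ x d → d ≤ dbl x → B (2 + n) (+ suc x) (suc x ⊖ (2 + d)) ≡ H (2 + n) (suc x) (2 + d)
    mirrored-step n rec x d p with m≤n⇒m<n∨m≡n p
    ... | inj₂ refl = trans (cong (B (2 + n) (+ suc x)) (reflected (suc x) (dbl (suc x)) (dbl≡+ (suc x))))
          (trans (mirror (2 + n) (+ suc x) (+ suc x)) (trans (diagonal (2 + n) (suc x)) (sym (H-antidiagonal (2 + n) (suc x)))))
    ... | inj₁ d< with m≤n⇒m<n∨m≡n d<
    mirrored-step n rec (suc x) d p | inj₁ d< | inj₂ refl =
        trans (cong (B (2 + n) (+ (2 + x))) (trans (suc⊖suc (suc x) (2 + dbl x)) (reflected (suc x) (dbl (suc x)) (dbl≡+ (suc x)))))
          (trans (mirror (2 + n) (+ (2 + x)) (+ suc x))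
            (trans (below-diagonal (2 + n) (suc x)) (sym (H-above-antidiagonal (2 + n) (suc x)))))
    mirrored-step n rec x d p | inj₁ d< | inj₁ d≤ = trans (step-right n x _)
      (grow (rec (suc x) (suc (suc d)) (s≤s (s≤s p)))
        (trans (around-right (suc n) x d)
          (cnt-cong (rec x d p) (rec x (1 + d) d<) (rec x (2 + d) d≤)
            (rec (1 + x) (1 + d) (≤-trans d< (m≤n+m _ 2))) (rec (1 + x) (3 + d) (s≤s (≤-trans d≤ (n≤1+n _))))
            (rec (2 + x) (2 + d) (≤-trans d≤ (m≤n+m _ 4))) (rec (2 + x) (3 + d) (s≤s (≤-trans d≤ (m≤n+m _ 3))))
            (rec (2 + x) (4 + d) (s≤s (s≤s (≤-trans d≤ (m≤n+m _ 2))))))))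

    mirrored-sector : ∀ n x d → d ≤ dbl x → B n (+ x) (x ⊖ d) ≡ H n x d
    mirrored-sector n x zero p = diagonal n x
    mirrored-sector n (suc x) (suc zero) p = below-diagonal n x
    mirrored-sector zero (suc x) (suc (suc d)) p = reach-x 0 (suc x) _ z≤n
    mirrored-sector (suc zero) (suc x) (suc (suc d)) p =
      trans (reach-x 1 (suc x) _ (s≤s z≤n)) (sym (H-reach-x 1 (suc x) (2 + d) (s≤s z≤n)))
    mirrored-sector (suc (suc n)) (suc x) (suc (suc d)) p = mirrored-step n (mirrored-sector (suc n)) x d (s≤s⁻¹ (s≤s⁻¹ p))

-- The corner versions and the full automaton as sectors

cell₀ cell₁ : Cell
cell₀ = + 0 , + 0
cell₁ = + 0 , + 1

allowed-above : ∀ i y → cornerAllowed (i , + suc (suc y)) ≡ true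
allowed-above (+ zero) y = refl
allowed-above (+ suc x) y = refl
allowed-above -[1+ zero ] y = refl
allowed-above -[1+ suc x ] y = refl

blocked-left : ∀ d → cornerAllowed (-[1+ d ] , + 1) ≡ false
blocked-left d = refl

blocked-left₀ : ∀ d → cornerAllowed (ℤ.1ℤ ℤ.+ -[1+ d ] , + 1) ≡ false
blocked-left₀ zero = refl
blocked-left₀ (suc d) = refl

blocked-below : ∀ d → cornerAllowed (+ 0 , ℤ.1ℤ ℤ.+ -[1+ d ]) ≡ false
blocked-below zero = refl
blocked-below (suc d) = refl

below-seed : ∀ a d → (a , ℤ.1ℤ ℤ.+ -[1+ d ]) ≢ cell₁
below-seed a zero ()
below-seed a (suc d) ()

+0≤ : ∀ {m n} → m ≤ n → m + 0 ≤ n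
+0≤ {m} {n} p = subst (_≤ n) (sym (+-identityʳ m)) p

+1≤ : ∀ {m n} → m ≤ n → m + 1 ≤ suc n
+1≤ {m} {n} p = subst (_≤ suc n) (+-comm 1 m) (s≤s p)

grown : Cell → (Cell → Bool) → ℕ → Cell → ℕ → Bool
grown s a n c k = on s a (1 + n) c ∨ (a c ∧ isOne k)

swap-frame : ∀ {u v} → Commutes u → Commutes v → ∀ (f : Cell → Bool) i j →
  countTrue (map f (neighbours (u j , v i))) ≡ cntℤ (λ i j → f (u j , v i)) i j
swap-frame {u} {v} U V f i j = trans (frame {u} {v} U V f j i) (cntℤ-transpose (λ j i → f (u j , v i)) j i)

-- Upper halves are transposed. For `firstUpper` the origin is `(1 , 1)`, turned on at stage 2,
-- because the cells `(i , 1)` with `i` at most 0 are blocked; hence the stage `1 + n`.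
firstLower firstUpper secondLower secondUpper full : Sector
firstLower = record
  { B = λ n i j → on cell₀ cornerAllowed n (i , j)
  ; allowed = λ i j → cornerAllowed (i , j)
  ; step = λ n i j → cong (grown cell₀ cornerAllowed n (i , j))
      (frame {λ i → i} {λ j → j} commutes-id commutes-id (on cell₀ cornerAllowed (1 + n)) i j)
  ; open-right = λ x j → refl
  ; reach-x = λ n x j p → on-reach-x cell₀ cornerAllowed n (+ x) j (+0≤ p)
  ; reach-y = λ n i y p → on-reach-y cell₀ cornerAllowed n i (+ y) (+0≤ p)
  ; seed = refl
  ; south = refl
  }
firstUpper = record
  { B = λ n i j → on cell₀ cornerAllowed (1 + n) (ℤ.1ℤ ℤ.+ j , ℤ.1ℤ ℤ.+ i)
  ; allowed = λ i j → cornerAllowed (ℤ.1ℤ ℤ.+ j , ℤ.1ℤ ℤ.+ i)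
  ; step = λ n i j → cong (grown cell₀ cornerAllowed (1 + n) (ℤ.1ℤ ℤ.+ j , ℤ.1ℤ ℤ.+ i))
      (swap-frame {ℤ._+_ ℤ.1ℤ} {ℤ._+_ ℤ.1ℤ} commutes-1+ commutes-1+ (on cell₀ cornerAllowed (2 + n)) i j)
  ; open-right = λ x j → allowed-above (ℤ.1ℤ ℤ.+ j) x
  ; reach-x = λ n x j p → on-reach-y cell₀ cornerAllowed (1 + n) (ℤ.1ℤ ℤ.+ j) (+ suc x) (s≤s (+0≤ p))
  ; reach-y = λ n i y p → on-reach-x cell₀ cornerAllowed (1 + n) (+ suc y) (ℤ.1ℤ ℤ.+ i) (s≤s (+0≤ p))
  ; seed = refl
  ; south = refl
  }
secondLower = record
  { B = λ n i j → on cell₁ cornerAllowed n (i , ℤ.1ℤ ℤ.+ j)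
  ; allowed = λ i j → cornerAllowed (i , ℤ.1ℤ ℤ.+ j)
  ; step = λ n i j → cong (grown cell₁ cornerAllowed n (i , ℤ.1ℤ ℤ.+ j))
      (frame {λ i → i} {ℤ._+_ ℤ.1ℤ} commutes-id commutes-1+ (on cell₁ cornerAllowed (1 + n)) i j)
  ; open-right = λ x j → refl
  ; reach-x = λ n x j p → on-reach-x cell₁ cornerAllowed n (+ x) (ℤ.1ℤ ℤ.+ j) (+0≤ p)
  ; reach-y = λ n i y p → on-reach-y cell₁ cornerAllowed n i (+ suc y) (+1≤ p)
  ; seed = refl
  ; south = refl
  }
secondUpper = record
  { B = λ n i j → on cell₁ cornerAllowed n (j , ℤ.1ℤ ℤ.+ i)
  ; allowed = λ i j → cornerAllowed (j , ℤ.1ℤ ℤ.+ i)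
  ; step = λ n i j → cong (grown cell₁ cornerAllowed n (j , ℤ.1ℤ ℤ.+ i))
      (swap-frame {λ i → i} {ℤ._+_ ℤ.1ℤ} commutes-id commutes-1+ (on cell₁ cornerAllowed (1 + n)) i j)
  ; open-right = λ x j → allowed-above j x
  ; reach-x = λ n x j p → on-reach-y cell₁ cornerAllowed n j (+ suc x) (+1≤ p)
  ; reach-y = λ n i y p → on-reach-x cell₁ cornerAllowed n (+ y) (ℤ.1ℤ ℤ.+ i) (+0≤ p)
  ; seed = refl
  ; south = refl
  }
full = record
  { B = λ n i j → on cell₀ everywhere n (i , j)
  ; allowed = λ i j → true
  ; step = λ n i j → cong (grown cell₀ everywhere n (i , j))
      (frame {λ i → i} {λ j → j} commutes-id commutes-id (on cell₀ everywhere (1 + n)) i j)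
  ; open-right = λ x j → refl
  ; reach-x = λ n x j p → on-reach-x cell₀ everywhere n (+ x) j (+0≤ p)
  ; reach-y = λ n i y p → on-reach-y cell₀ everywhere n i (+ y) (+0≤ p)
  ; seed = refl
  ; south = refl
  }

firstLower-H : ∀ n x d → on cell₀ cornerAllowed n (+ x , x ⊖ d) ≡ H n x d
firstLower-H = SectorProperties.sector firstLower λ n d → on-blocked cell₀ cornerAllowed n (+ 0 , -[1+ d ]) refl λ ()

firstUpper-H : ∀ n x d → on cell₀ cornerAllowed (1 + n) (suc x ⊖ d , + suc x) ≡ H n x d
firstUpper-H n x d = trans (cong (λ i → on cell₀ cornerAllowed (1 + n) (i , + suc x)) (sym (ℤₚ.distribʳ-⊖-+-pos 1 x d)))
  (SectorProperties.sector firstUpper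
    (λ n d → on-blocked cell₀ cornerAllowed (1 + n) (ℤ.1ℤ ℤ.+ -[1+ d ] , + 1) (blocked-left₀ d) λ ()) n x d)

secondLower-H : ∀ n x d → on cell₁ cornerAllowed n (+ x , ℤ.1ℤ ℤ.+ (x ⊖ d)) ≡ H n x d
secondLower-H = SectorProperties.sector secondLower λ n d →
  on-blocked cell₁ cornerAllowed n (+ 0 , ℤ.1ℤ ℤ.+ -[1+ d ]) (blocked-below d) (below-seed (+ 0) d)

secondUpper-H : ∀ n x d → on cell₁ cornerAllowed n (x ⊖ d , + suc x) ≡ H n x d
secondUpper-H = SectorProperties.sector secondUpper λ n d → on-blocked cell₁ cornerAllowed n (-[1+ d ] , + 1) (blocked-left d) λ ()

full-transpose : ∀ n i j → on cell₀ everywhere n (i , j) ≡ on cell₀ everywhere n (j , i)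
full-transpose zero i j = refl
full-transpose (suc zero) i j = ∧-comm ⌊ i ℤₚ.≟ + 0 ⌋ ⌊ j ℤₚ.≟ + 0 ⌋
full-transpose (suc (suc n)) i j = step (full-transpose (suc n))
  where
  F : Cell → Bool
  F = on cell₀ everywhere (suc n)
  step : (∀ i j → F (i , j) ≡ F (j , i)) → on cell₀ everywhere (2 + n) (i , j) ≡ on cell₀ everywhere (2 + n) (j , i)
  step t = grow (t i j)
    (trans (frame {λ i → i} {λ j → j} commutes-id commutes-id F i j)
      (trans (cnt-cong (t _ _) (t _ _) (t _ _) (t _ _) (t _ _) (t _ _) (t _ _) (t _ _))
        (sym (swap-frame {λ i → i} {λ j → j} commutes-id commutes-id F i j))))

full-mirror : ∀ n i j → on cell₀ everywhere n (i , ℤ.- j) ≡ on cell₀ everywhere n (i , j)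
full-mirror zero i j = refl
full-mirror (suc zero) i (+ zero) = refl
full-mirror (suc zero) i (+ suc j) = refl
full-mirror (suc zero) i -[1+ j ] = refl
full-mirror (suc (suc n)) i j = step (full-mirror (suc n))
  where
  F : Cell → Bool
  F = on cell₀ everywhere (suc n)
  f : ℤ → ℤ → Bool
  f i j = F (i , j)
  step : (∀ i j → f i (ℤ.- j) ≡ f i j) → on cell₀ everywhere (2 + n) (i , ℤ.- j) ≡ on cell₀ everywhere (2 + n) (i , j)
  step mirror = grow (mirror i j)
    (trans (frame {λ i → i} {λ j → j} commutes-id commutes-id F i (ℤ.- j))
      (trans (cnt-cong (down _) (mirror _ j) (up _) (down i) (up i) (down _) (mirror _ j) (up _))
        (trans (cnt-reflect (f (i ℤ.+ ℤ.-1ℤ) (j ℤ.+ ℤ.1ℤ)) (f (i ℤ.+ ℤ.-1ℤ) j) (f (i ℤ.+ ℤ.-1ℤ) (j ℤ.+ ℤ.-1ℤ))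
                  (f i (j ℤ.+ ℤ.1ℤ)) (f i (j ℤ.+ ℤ.-1ℤ))
                  (f (i ℤ.+ ℤ.1ℤ) (j ℤ.+ ℤ.1ℤ)) (f (i ℤ.+ ℤ.1ℤ) j) (f (i ℤ.+ ℤ.1ℤ) (j ℤ.+ ℤ.-1ℤ)))
          (sym (frame {λ i → i} {λ j → j} commutes-id commutes-id F i j)))))
    where
    down : ∀ i → f i (ℤ.- j ℤ.+ ℤ.1ℤ) ≡ f i (j ℤ.+ ℤ.-1ℤ)
    down i = trans (cong (f i) (sym (ℤₚ.neg-distrib-+ j ℤ.-1ℤ))) (mirror i (j ℤ.+ ℤ.-1ℤ))
    up : ∀ i → f i (ℤ.- j ℤ.+ ℤ.-1ℤ) ≡ f i (j ℤ.+ ℤ.1ℤ)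
    up i = trans (cong (f i) (sym (ℤₚ.neg-distrib-+ j ℤ.1ℤ))) (mirror i (j ℤ.+ ℤ.1ℤ))

full-H : ∀ n x d → d ≤ dbl x → on cell₀ everywhere n (+ x , x ⊖ d) ≡ H n x d
full-H = SectorProperties.mirrored-sector full full-mirror

-- Counting over the box

total : ∀ {A : Set} → (A → ℕ) → List A → ℕ
total f [] = 0
total f (x ∷ xs) = f x + total f xs

total-filter : ∀ {A : Set} (f : A → Bool) xs → length (filter (λ c → f c Bool.≟ true) xs) ≡ total (λ c → ⟦ f c ⟧) xs
total-filter f [] = refl
total-filter f (x ∷ xs) with f x
... | true = cong suc (total-filter f xs)
... | false = total-filter f xs

total-++ : ∀ {A : Set} (f : A → ℕ) xs ys → total f (xs ++ ys) ≡ total f xs + total f ys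
total-++ f [] ys = refl
total-++ f (x ∷ xs) ys = trans (cong (_+_ (f x)) (total-++ f xs ys)) (sym (+-assoc (f x) _ _))

total-concatMap : ∀ {A B : Set} (f : B → ℕ) (g : A → List B) xs → total f (concatMap g xs) ≡ total (λ x → total f (g x)) xs
total-concatMap f g [] = refl
total-concatMap f g (x ∷ xs) = trans (total-++ f (g x) (concatMap g xs)) (cong (_+_ (total f (g x))) (total-concatMap f g xs))

total-map : ∀ {A B : Set} (f : B → ℕ) (g : A → B) xs → total f (map g xs) ≡ total (λ x → f (g x)) xs
total-map f g [] = refl
total-map f g (x ∷ xs) = cong (_+_ (f (g x))) (total-map f g xs)

total-applyUpTo : ∀ {A : Set} (f : A → ℕ) g n → total f (applyUpTo g n) ≡ sum n (λ i → f (g i))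
total-applyUpTo f g zero = refl
total-applyUpTo f g (suc n) = cong (_+_ (f (g 0))) (total-applyUpTo f (λ i → g (suc i)) n)

total-range : ∀ R (f : ℤ → ℕ) → total f (range R) ≡ sum (suc (R + R)) (λ k → f (k ⊖ R))
total-range R f = trans (total-map f (λ k → (+ k) ℤ.- (+ R)) (upTo (suc (R + R))))
  (trans (total-applyUpTo (λ k → f ((+ k) ℤ.- (+ R))) (λ i → i) (suc (R + R))) (sum-cong (suc (R + R)) λ k _ → cong f (ℤₚ.[+m]-[+n]≡m⊖n k R)))

total-cong : ∀ {A : Set} {f g : A → ℕ} → (∀ x → f x ≡ g x) → ∀ xs → total f xs ≡ total g xs
total-cong e [] = refl
total-cong e (x ∷ xs) = cong₂ _+_ (e x) (total-cong e xs)

square : ℕ → (ℤ → ℤ → ℕ) → ℕ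
square R f = sum (suc (R + R)) (λ k → sum (suc (R + R)) (λ l → f (k ⊖ R) (l ⊖ R)))

born : Cell → (Cell → Bool) → ℕ → ℤ → ℤ → ℕ
born s a n i j = ⟦ turnsOn s a n (i , j) ⟧

count-square : ∀ s a n → count s a n ≡ square (suc n) (born s a n)
count-square s a n = trans (total-filter (turnsOn s a n) (box (suc n)))
  (trans (total-concatMap (λ c → ⟦ turnsOn s a n c ⟧) (λ i → map (λ j → i , j) (range (suc n))) (range (suc n)))
    (trans (total-cong (λ i → trans (total-map (λ c → ⟦ turnsOn s a n c ⟧) (λ j → i , j) (range (suc n))) (total-range (suc n) (born s a n i))) (range (suc n)))
      (total-range (suc n) (λ i → sum (suc (suc n + suc n)) (λ l → born s a n i (l ⊖ suc n))))))

sum-square : ∀ N (f : ℕ → ℕ → ℕ) →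
  sum N (λ k → sum N (f k)) ≡ sum N (λ k → f k k + sum k (λ m → f k m + f m k))
sum-square zero f = refl
sum-square (suc N) f = begin
  sum (suc N) (λ k → sum (suc N) (f k))
    ≡⟨ sum-last N (λ k → sum (suc N) (f k)) ⟩
  sum N (λ k → sum (suc N) (f k)) + sum (suc N) (f N)
    ≡⟨ cong₂ _+_ (trans (sum-cong N λ k _ → sum-last N (f k)) (sum-+ N (λ k → sum N (f k)) (λ k → f k N))) (sum-last N (f N)) ⟩
  sum N (λ k → sum N (f k)) + sum N (λ k → f k N) + (sum N (f N) + f N N)
    ≡⟨ rearrange (sum N (λ k → sum N (f k))) (sum N (λ k → f k N)) (sum N (f N)) (f N N) ⟩
  sum N (λ k → sum N (f k)) + (f N N + (sum N (f N) + sum N (λ k → f k N)))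
    ≡⟨ cong₂ (λ a b → a + (f N N + b)) (sum-square N f) (sym (sum-+ N (f N) (λ k → f k N))) ⟩
  sum N (λ k → f k k + sum k (λ m → f k m + f m k)) + (f N N + sum N (λ m → f N m + f m N))
    ≡⟨ sym (sum-last N (λ k → f k k + sum k (λ m → f k m + f m k))) ⟩
  sum (suc N) (λ k → f k k + sum k (λ m → f k m + f m k)) ∎
  where
  open ≡-Reasoning
  rearrange : ∀ a b c d → a + b + (c + d) ≡ a + (d + (c + b))
  rearrange = solve-∀

⊖-offset : ∀ R x m d → m + suc d ≡ R + x → m ⊖ R ≡ x ⊖ suc d
⊖-offset R x m d e = trans (sym (ℤₚ.+-cancelˡ-⊖ (suc d) m R))
  (trans (cong₂ _⊖_ (trans (+-comm (suc d) m) e) (+-comm (suc d) R)) (ℤₚ.+-cancelˡ-⊖ R x (suc d)))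

⊖-negative : ∀ {m R} → m < R → ∃ λ o → m ⊖ R ≡ -[1+ o ]
⊖-negative {m} {R} p with gap p
... | o , refl = o , ⊖-offset (suc (o + m)) 0 m o (trans (+-comm m (suc o)) (sym (+-identityʳ _)))

-- The square is cut along `x = y`. With the negative quadrant dead, what remains is, for each `x`
-- from 0 on, the cell `(x , x)`, the column below it and the row to its left.
sum-corner : ∀ R f → (∀ a b → f -[1+ a ] -[1+ b ] ≡ 0) → square R f ≡
  sum (suc R) (λ x → f (+ x) (+ x) + (sum (R + x) (λ d → f (+ x) (x ⊖ suc d)) + sum (R + x) (λ d → f (x ⊖ suc d) (+ x))))
sum-corner R f dead = begin
  square R f
    ≡⟨ sum-square (suc (R + R)) F ⟩
  sum (suc (R + R)) G
    ≡⟨ cong (λ N → sum N G) (sym (+-suc R R)) ⟩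
  sum (R + suc R) G
    ≡⟨ sum-split R (suc R) G ⟩
  sum R G + sum (suc R) (λ x → G (R + x))
    ≡⟨ cong₂ _+_ (sum-zero R λ k p → cong₂ _+_ (off k k p p) (sum-zero k λ m q → cong₂ _+_ (off k m p (<-trans q p)) (off m k (<-trans q p) p)))
         (sum-cong (suc R) λ x _ → cong₂ _+_ (cong₂ f (centre x) (centre x)) (row x)) ⟩
  sum (suc R) (λ x → f (+ x) (+ x) + (sum (R + x) (λ d → f (+ x) (x ⊖ suc d)) + sum (R + x) (λ d → f (x ⊖ suc d) (+ x)))) ∎
  where
  open ≡-Reasoning
  F : ℕ → ℕ → ℕ
  F k l = f (k ⊖ R) (l ⊖ R)
  G : ℕ → ℕ
  G k = F k k + sum k (λ m → F k m + F m k)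
  off : ∀ k l → k < R → l < R → F k l ≡ 0
  off k l p q with ⊖-negative p | ⊖-negative q
  ... | a , e | b , e′ = trans (cong₂ f e e′) (dead a b)
  centre : ∀ x → (R + x) ⊖ R ≡ + x
  centre x = trans (cong ((R + x) ⊖_) (sym (+-identityʳ R))) (ℤₚ.+-cancelˡ-⊖ R x 0)
  row : ∀ x → sum (R + x) (λ m → F (R + x) m + F m (R + x)) ≡
    sum (R + x) (λ d → f (+ x) (x ⊖ suc d)) + sum (R + x) (λ d → f (x ⊖ suc d) (+ x))
  row x = trans (sum-reverse (R + x) _) (trans
    (sum-cong (R + x) λ d p → cong₂ _+_ (cong₂ f (centre x) (position d p)) (cong₂ f (position d p) (centre x)))
    (sum-+ (R + x) (λ d → f (+ x) (x ⊖ suc d)) (λ d → f (x ⊖ suc d) (+ x))))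
    where
    position : ∀ d → d < R + x → (R + x ∸ suc d) ⊖ R ≡ x ⊖ suc d
    position d p = ⊖-offset R x (R + x ∸ suc d) d (m∸n+n≡m p)

⊖-centre : ∀ R x → (R + x) ⊖ R ≡ + x
⊖-centre R x = trans (cong ((R + x) ⊖_) (sym (+-identityʳ R))) (ℤₚ.+-cancelˡ-⊖ R x 0)

-- Moves the counting window up by one row, to centre it at the seed `(0 , 1)`.
sum-shift : ∀ N (g : ℕ → ℕ) → g 0 ≡ 0 → g N ≡ 0 → sum N g ≡ sum N (λ l → g (suc l))
sum-shift N g g0 gN = begin
  sum N g                           ≡⟨ sym (+-identityʳ _) ⟩
  sum N g + 0                       ≡⟨ cong (_+_ (sum N g)) (sym gN) ⟩
  sum N g + g N                     ≡⟨ sym (sum-last N g) ⟩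
  g 0 + sum N (λ l → g (suc l))     ≡⟨ cong (_+ sum N (λ l → g (suc l))) g0 ⟩
  sum N (λ l → g (suc l))           ∎
  where open ≡-Reasoning

sum-diagonal : ∀ n m → n ≤ m → sum (suc m) (λ x → bornH n x 0) ≡ 1
sum-diagonal n m n≤m = trans (sum-extend {f = λ x → bornH n x 0} (s≤s n≤m) λ x p → unborn {c = not (x <ᵇ n)} (<ᵇ-false p)) (trans (sum-last n (λ x → bornH n x 0))
  (cong₂ _+_ (sum-zero n λ x p → unchanged (trans (<ᵇ-true (m≤n⇒m≤1+n p)) (sym (<ᵇ-true p))))
    (born-cong (<ᵇ-true (n<1+n n)) (<ᵇ-false (≤-refl {n})))))

sizeH-wide : ∀ n m (w : ℕ → ℕ) → n < m → (∀ x → n + x ≤ w x) →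
  sum m (λ x → sum (w x) (λ d → bornH n x (suc d))) ≡ sizeH n
sizeH-wide n m w n<m wide = trans
  (sum-extend n<m λ x p → sum-zero (w x) λ d _ → unborn (H-reach-x (suc n) x (suc d) p))
  (sum-cong (suc n) λ x _ → sum-extend (wide x) λ d p → bornH-reach n x (suc d) (s≤s p))

v₂-size : ∀ n → v₂ (suc n) ≡ 1 + (sizeH n + sizeH n)
v₂-size n = begin
  v₂ (suc n)
    ≡⟨ count-square cell₁ cornerAllowed (suc n) ⟩
  square R b
    ≡⟨ sum-cong (suc (R + R)) (λ k _ → shifted (k ⊖ R)) ⟩
  square R (λ i j → b i (ℤ.1ℤ ℤ.+ j))
    ≡⟨ sum-corner R (λ i j → b i (ℤ.1ℤ ℤ.+ j)) dead ⟩
  sum (suc R) (λ x → b (+ x) (+ suc x) + (sum (R + x) (λ d → b (+ x) (ℤ.1ℤ ℤ.+ (x ⊖ suc d))) + sum (R + x) (λ d → b (x ⊖ suc d) (+ suc x))))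
    ≡⟨ sum-cong (suc R) (λ x _ → cong₂ _+_ (lower x 0) (cong₂ _+_ (sum-cong (R + x) λ d _ → lower x (suc d)) (sum-cong (R + x) λ d _ → upper x (suc d)))) ⟩
  sum (suc R) (λ x → bornH n x 0 + (sum (R + x) (λ d → bornH n x (suc d)) + sum (R + x) (λ d → bornH n x (suc d))))
    ≡⟨ trans (sum-+ (suc R) (λ x → bornH n x 0) (λ x → row x + row x)) (cong (_+_ (sum (suc R) (λ x → bornH n x 0))) (sum-+ (suc R) row row)) ⟩
  sum (suc R) (λ x → bornH n x 0) + (sum (suc R) row + sum (suc R) row)
    ≡⟨ cong₂ _+_ (sum-diagonal n R (m≤n+m n 2)) (cong₂ _+_ size size) ⟩
  1 + (sizeH n + sizeH n) ∎
  where
  open ≡-Reasoning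
  R : ℕ
  R = 2 + n
  b : ℤ → ℤ → ℕ
  b = born cell₁ cornerAllowed (suc n)
  row : ℕ → ℕ
  row x = sum (R + x) (λ d → bornH n x (suc d))
  far : ∀ i j → 2 + n ≤ ∣ j ∣ → b i j ≡ 0
  far i j p = unborn (on-reach-y cell₁ cornerAllowed (suc n) i j (≤-trans (≤-reflexive (+-comm (suc n) 1)) p))
  shifted : ∀ i → sum (suc (R + R)) (λ l → b i (l ⊖ R)) ≡ sum (suc (R + R)) (λ l → b i (ℤ.1ℤ ℤ.+ (l ⊖ R)))
  shifted i = trans (sum-shift (suc (R + R)) (λ l → b i (l ⊖ R)) (far i -[1+ suc n ] ≤-refl)
      (trans (cong (b i) (trans (cong (_⊖ R) (sym (+-suc R R))) (⊖-centre R (suc R)))) (far i (+ suc R) (n≤1+n _))))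
    (sum-cong (suc (R + R)) λ l _ → cong (b i) (sym (ℤₚ.distribʳ-⊖-+-pos 1 l R)))
  dead : ∀ x y → b -[1+ x ] (ℤ.1ℤ ℤ.+ -[1+ y ]) ≡ 0
  dead x y = unborn (on-blocked cell₁ cornerAllowed (suc n) _ (blocked y) λ ())
    where
    blocked : ∀ y → cornerAllowed (-[1+ x ] , ℤ.1ℤ ℤ.+ -[1+ y ]) ≡ false
    blocked zero = refl
    blocked (suc y) = refl
  lower : ∀ x d → b (+ x) (ℤ.1ℤ ℤ.+ (x ⊖ d)) ≡ bornH n x d
  lower x d = born-cong (secondLower-H (suc n) x d) (secondLower-H n x d)
  upper : ∀ x d → b (x ⊖ d) (+ suc x) ≡ bornH n x d
  upper x d = born-cong (secondUpper-H (suc n) x d) (secondUpper-H n x d)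
  size : sum (suc R) row ≡ sizeH n
  size = sizeH-wide n (suc R) (_+_ R) (m≤n+m (suc n) 2) λ x → +-monoˡ-≤ x (m≤n+m n 2)

v₁-size : ∀ n → v₁ (2 + n) ≡ 1 + (sizeH (1 + n) + sizeH n)
v₁-size n = begin
  v₁ (2 + n)
    ≡⟨ count-square cell₀ cornerAllowed (2 + n) ⟩
  square R b
    ≡⟨ sum-corner R b dead ⟩
  sum (suc R) (λ x → b (+ x) (+ x) + (sum (R + x) (λ d → b (+ x) (x ⊖ suc d)) + sum (R + x) (λ d → b (x ⊖ suc d) (+ x))))
    ≡⟨ sum-cong (suc R) (λ x _ → cong₂ _+_ (lower x 0) (cong (_+ upper x) (sum-cong (R + x) λ d _ → lower x (suc d)))) ⟩
  sum (suc R) (λ x → bornH (1 + n) x 0 + (row x + upper x))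
    ≡⟨ trans (sum-+ (suc R) (λ x → bornH (1 + n) x 0) (λ x → row x + upper x)) (cong (_+_ (sum (suc R) (λ x → bornH (1 + n) x 0))) (sum-+ (suc R) row upper)) ⟩
  sum (suc R) (λ x → bornH (1 + n) x 0) + (sum (suc R) row + sum (suc R) upper)
    ≡⟨ cong₂ _+_ (sum-diagonal (1 + n) R (m≤n+m (1 + n) 2)) (cong₂ _+_
         (sizeH-wide (1 + n) (suc R) (_+_ R) (m≤n+m (2 + n) 2) λ x → +-monoˡ-≤ x (m≤n+m (1 + n) 2)) size) ⟩
  1 + (sizeH (1 + n) + sizeH n) ∎
  where
  open ≡-Reasoning
  R : ℕ
  R = 3 + n
  b : ℤ → ℤ → ℕ
  b = born cell₀ cornerAllowed (2 + n)
  row upper : ℕ → ℕ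
  row x = sum (R + x) (λ d → bornH (1 + n) x (suc d))
  upper x = sum (R + x) (λ d → b (x ⊖ suc d) (+ x))
  dead : ∀ x y → b -[1+ x ] -[1+ y ] ≡ 0
  dead x y = unborn (on-blocked cell₀ cornerAllowed (2 + n) (-[1+ x ] , -[1+ y ]) refl λ ())
  dead₀ : ∀ x → b -[1+ x ] (+ 0) ≡ 0
  dead₀ x = unborn (on-blocked cell₀ cornerAllowed (2 + n) (-[1+ x ] , + 0) refl λ ())
  lower : ∀ x d → b (+ x) (x ⊖ d) ≡ bornH (1 + n) x d
  lower x d = born-cong (firstLower-H (2 + n) x d) (firstLower-H (1 + n) x d)
  size : sum (suc R) upper ≡ sizeH n
  -- The row `y = 0` left of the seed is dead; the rows from `y = 1` on form the half that starts at
  -- `(1 , 1)` a stage late.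
  size = cong₂ _+_
    (sum-zero (R + 0) λ d _ → dead₀ d)
    (trans (sum-cong R λ x _ → sum-cong (R + suc x) λ d _ → born-cong (firstUpper-H (1 + n) x (suc d)) (firstUpper-H n x (suc d)))
      (sizeH-wide n R (λ x → R + suc x) (m≤n+m (suc n) 2) λ x → +-mono-≤ (m≤n+m n 3) (n≤1+n x)))

sum-symmetric : ∀ R (g : ℤ → ℕ) → (∀ k → g -[1+ k ] ≡ g (+ suc k)) →
  sum (suc (R + R)) (λ k → g (k ⊖ R)) ≡ g (+ 0) + 2 * sum R (λ x → g (+ suc x))
sum-symmetric R g even = begin
  sum (suc (R + R)) (λ k → g (k ⊖ R))
    ≡⟨ cong (λ N → sum N (λ k → g (k ⊖ R))) (sym (+-suc R R)) ⟩
  sum (R + suc R) (λ k → g (k ⊖ R))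
    ≡⟨ sum-split R (suc R) (λ k → g (k ⊖ R)) ⟩
  sum R (λ k → g (k ⊖ R)) + sum (suc R) (λ x → g ((R + x) ⊖ R))
    ≡⟨ cong₂ _+_ (trans (sum-reverse R (λ k → g (k ⊖ R))) (sum-cong R λ d p → trans (cong g (position d p)) (even d)))
         (sum-cong (suc R) λ x _ → cong g (⊖-centre R x)) ⟩
  s + (g (+ 0) + s)
    ≡⟨ rearrange s (g (+ 0)) ⟩
  g (+ 0) + 2 * s ∎
  where
  open ≡-Reasoning
  s : ℕ
  s = sum R (λ x → g (+ suc x))
  rearrange : ∀ s a → s + (a + s) ≡ a + 2 * s
  rearrange = solve-∀
  position : ∀ d → d < R → (R ∸ suc d) ⊖ R ≡ -[1+ d ]
  position d p = ⊖-offset R 0 (R ∸ suc d) d (trans (m∸n+n≡m p) (sym (+-identityʳ R)))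

-- From stage 3 on nothing is born on the axes, which leaves four equal open quadrants.
-- Transposition splits each into one diagonal birth and two octants.
v-size : ∀ n → v (3 + n) ≡ 4 * (1 + 2 * sizeW 0 (2 + n))
v-size n = begin
  v (3 + n)
    ≡⟨ count-square cell₀ everywhere (3 + n) ⟩
  square R b
    ≡⟨ sum-symmetric R column (λ k → sum-cong (suc (R + R)) λ l _ → trans (transpose -[1+ k ] (l ⊖ R)) (trans (mirror (l ⊖ R) k) (transpose (l ⊖ R) (+ suc k)))) ⟩
  column (+ 0) + 2 * sum R (λ x → column (+ suc x))
    ≡⟨ cong₂ (λ a c → a + 2 * c) (sum-symmetric R (b (+ 0)) (mirror (+ 0))) (sum-cong R λ x _ → sum-symmetric R (b (+ suc x)) (mirror (+ suc x))) ⟩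
  b (+ 0) (+ 0) + 2 * sum R (λ y → b (+ 0) (+ suc y)) + 2 * sum R (λ x → b (+ suc x) (+ 0) + 2 * sum R (λ y → b (+ suc x) (+ suc y)))
    ≡⟨ cong₂ _+_ (cong₂ (λ a c → a + 2 * c) (axis 0) (sum-zero R λ y _ → trans (transpose (+ 0) (+ suc y)) (axis (suc y))))
         (cong (2 *_) (sum-cong R λ x _ → cong (_+ 2 * sum R (λ y → b (+ suc x) (+ suc y))) (axis (suc x)))) ⟩
  2 * sum R (λ x → 2 * sum R (λ y → b (+ suc x) (+ suc y)))
    ≡⟨ trans (cong (2 *_) (sum-* R 2 (λ x → sum R (λ y → b (+ suc x) (+ suc y))))) (sym (*-assoc 2 2 quadrant)) ⟩
  4 * quadrant
    ≡⟨ cong (4 *_) size ⟩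
  4 * (1 + 2 * sizeW 0 (2 + n)) ∎
  where
  open ≡-Reasoning
  R quadrant : ℕ
  R = 4 + n
  b : ℤ → ℤ → ℕ
  b = born cell₀ everywhere (3 + n)
  column : ℤ → ℕ
  column i = sum (suc (R + R)) (λ l → b i (l ⊖ R))
  quadrant = sum R (λ x → sum R (λ y → b (+ suc x) (+ suc y)))
  transpose : ∀ i j → b i j ≡ b j i
  transpose i j = born-cong (full-transpose (3 + n) i j) (full-transpose (2 + n) i j)
  mirror : ∀ i k → b i -[1+ k ] ≡ b i (+ suc k)
  mirror i k = born-cong (full-mirror (3 + n) i (+ suc k)) (full-mirror (2 + n) i (+ suc k))
  lower : ∀ x d → d ≤ dbl x → b (+ x) (x ⊖ d) ≡ bornH (2 + n) x d
  lower x d p = born-cong (full-H (3 + n) x d p) (full-H (2 + n) x d p)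
  ≤dbl : ∀ x → x ≤ dbl x
  ≤dbl x = ≤-trans (m≤m+n x x) (+≤dbl x)
  axis : ∀ x → b (+ x) (+ 0) ≡ 0
  axis zero = lower 0 0 z≤n
  axis (suc x) = trans (cong (b (+ suc x)) (sym (ℤₚ.n⊖n≡0 (suc x)))) (trans (lower (suc x) (suc x) (≤dbl (suc x))) (rowH-axis n x))
  row : ∀ k → sum k (λ m → b (+ suc k) (+ suc m) + b (+ suc m) (+ suc k)) ≡ 2 * rowW 0 (2 + n) k
  row k = trans (sum-cong k λ m _ → cong (_+_ (b (+ suc k) (+ suc m))) (trans (transpose (+ suc m) (+ suc k)) (sym (+-identityʳ _))))
    (trans (sum-* k 2 (λ m → b (+ suc k) (+ suc m))) (cong (2 *_) (trans (sum-reverse k (λ m → b (+ suc k) (+ suc m)))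
      (trans (sum-cong k λ d p → trans (cong (b (+ suc k)) (position d p)) (lower (suc k) (suc d) (≤-trans p (≤-trans (n≤1+n k) (≤dbl (suc k))))))
        (rowH-upper (2 + n) k)))))
    where
    position : ∀ d → d < k → + suc (k ∸ suc d) ≡ suc k ⊖ suc d
    position d p = trans (cong +_ (sym (+-∸-assoc 1 p))) (sym (ℤₚ.⊖-≥ (≤-trans p (n≤1+n k))))
  size : quadrant ≡ 1 + 2 * sizeW 0 (2 + n)
  size = trans (sum-square R (λ x y → b (+ suc x) (+ suc y))) (trans
    (sum-cong R λ k _ → cong₂ _+_ (lower (suc k) 0 z≤n) (row k))
    (trans (sum-+ R (frontal (2 + n)) (λ k → 2 * rowW 0 (2 + n) k)) (cong₂ _+_
      (trans (sum-extend {f = frontal (2 + n)} (m≤n+m (2 + n) 2) λ x p → unborn {c = not (suc x <ᵇ 2 + n)} (<ᵇ-false p)) (sum-frontal (suc n)))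
      (trans (sum-* R 2 (rowW 0 (2 + n))) (cong (2 *_) (sum-extend {f = rowW 0 (2 + n)} (m≤n+m (2 + n) 2) λ x p →
        trans (sym (rowH-upper (2 + n) x)) (sum-zero x λ d _ → unborn (H-reach-x (3 + n) (suc x) (suc d) (s≤s p)))))))))

-- The recurrences

module Recurrences (m : ℕ) (level : Level (suc m)) where

  M L : ℕ
  M = suc m
  L = suc M

  early : ∀ n → n < m → sizeH (n + L) ≡ 2 * sizeH n + (1 + sizeH (suc n))
  early n p = sizeH-early M level n (s≤s p)

  v₁-second : 0 < m → v₁ (L + 1) ≡ sizeH M + 1 + 3
  v₁-second p = trans (cong v₁ (+-comm L 1)) (trans (v₁-size M)
    -- By evaluation `sizeH 0` is 0 and `sizeH 1` is 2, so `early` contributes 3.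
    (trans (cong (λ h → 1 + (h + sizeH M)) (early 0 p)) (shuffle (sizeH M))))
    where
    shuffle : ∀ h → 1 + (3 + h) ≡ h + 1 + 3
    shuffle = solve-∀

  v₁-early : ∀ i → 2 ≤ i → i ≤ L ∸ 2 → v₁ (L + i) ≡ 2 * v₁ i + v₁ (i + 1)
  v₁-early (suc (suc n)) (s≤s (s≤s z≤n)) p = begin
    v₁ (L + (2 + n))
      ≡⟨ cong v₁ (+-comm L (2 + n)) ⟩
    v₁ (2 + (n + L))
      ≡⟨ v₁-size (n + L) ⟩
    1 + (sizeH (1 + n + L) + sizeH (n + L))
      ≡⟨ cong₂ (λ a b → 1 + (a + b)) (early (1 + n) p) (early n (≤-trans (n≤1+n _) p)) ⟩
    1 + (2 * sizeH (1 + n) + (1 + sizeH (2 + n)) + (2 * sizeH n + (1 + sizeH (1 + n))))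
      ≡⟨ shuffle (sizeH n) (sizeH (1 + n)) (sizeH (2 + n)) ⟩
    2 * (1 + (sizeH (1 + n) + sizeH n)) + (1 + (sizeH (2 + n) + sizeH (1 + n)))
      ≡⟨ cong₂ (λ a b → 2 * a + b) (sym (v₁-size n)) (trans (sym (v₁-size (1 + n))) (cong v₁ (+-comm 1 (2 + n)))) ⟩
    2 * v₁ (2 + n) + v₁ (2 + n + 1) ∎
    where
    open ≡-Reasoning
    shuffle : ∀ a b c → 1 + (2 * b + (1 + c) + (2 * a + (1 + b))) ≡ 2 * (1 + (b + a)) + (1 + (c + b))
    shuffle = solve-∀

  v₂-early : ∀ i → 1 ≤ i → i ≤ L ∸ 2 → v₂ (L + i) ≡ v₂ i + 2 * v₁ (i + 1)
  v₂-early (suc n) (s≤s z≤n) p = begin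
    v₂ (L + suc n)
      ≡⟨ cong v₂ (+-comm L (suc n)) ⟩
    v₂ (suc (n + L))
      ≡⟨ v₂-size (n + L) ⟩
    1 + (sizeH (n + L) + sizeH (n + L))
      ≡⟨ cong (λ h → 1 + (h + h)) (early n p) ⟩
    1 + (2 * sizeH n + (1 + sizeH (1 + n)) + (2 * sizeH n + (1 + sizeH (1 + n))))
      ≡⟨ shuffle (sizeH n) (sizeH (1 + n)) ⟩
    1 + (sizeH n + sizeH n) + 2 * (1 + (sizeH (1 + n) + sizeH n))
      ≡⟨ cong₂ (λ a b → a + 2 * b) (sym (v₂-size n)) (trans (sym (v₁-size n)) (cong v₁ (+-comm 1 (suc n)))) ⟩
    v₂ (suc n) + 2 * v₁ (suc n + 1) ∎
    where
    open ≡-Reasoning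
    shuffle : ∀ a b → 1 + (2 * a + (1 + b) + (2 * a + (1 + b))) ≡ 1 + (a + a) + 2 * (1 + (b + a))
    shuffle = solve-∀

  -- Both halves lose a cell to the wall at this stage, hence the 2.
  v₂-last : v₂ (L + (L ∸ 1)) + 2 ≡ v₂ (L ∸ 1) + 2 * v₁ (L ∸ 1 + 1)
  v₂-last = begin
    v₂ (L + M) + 2
      ≡⟨ cong (λ n → v₂ n + 2) (+-comm L M) ⟩
    v₂ (suc (m + L)) + 2
      ≡⟨ cong (_+ 2) (v₂-size (m + L)) ⟩
    1 + (sizeH (m + L) + sizeH (m + L)) + 2
      ≡⟨ cong (λ h → 1 + (h + h) + 2) (sizeH-late m level) ⟩
    1 + (2 * sizeH m + sizeH M + (2 * sizeH m + sizeH M)) + 2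
      ≡⟨ shuffle (sizeH m) (sizeH M) ⟩
    1 + (sizeH m + sizeH m) + 2 * (1 + (sizeH M + sizeH m))
      ≡⟨ cong₂ (λ a b → a + 2 * b) (sym (v₂-size m)) (trans (sym (v₁-size m)) (cong v₁ (+-comm 1 M))) ⟩
    v₂ M + 2 * v₁ (M + 1) ∎
    where
    open ≡-Reasoning
    shuffle : ∀ a b → 1 + (2 * a + b + (2 * a + b)) + 2 ≡ 1 + (a + a) + 2 * (1 + (b + a))
    shuffle = solve-∀

  v-copy : ∀ i → 1 ≤ i → i ≤ L ∸ 1 → v (L + i) ≡ 4 * v₂ i
  v-copy (suc n) (s≤s z≤n) p = begin
    v (L + suc n)
      ≡⟨ cong v (trans (+-comm L (suc n)) (cong suc n+L)) ⟩
    v (3 + (n + m))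
      ≡⟨ v-size (n + m) ⟩
    4 * (1 + 2 * sizeW 0 (2 + (n + m)))
      ≡⟨ cong (λ k → 4 * (1 + 2 * sizeW 0 k)) (sym n+L) ⟩
    4 * (1 + 2 * sizeW 0 (n + L))
      ≡⟨ cong (λ h → 4 * (1 + 2 * h)) (octant-size M level n (≤-trans (n≤1+n n) p)) ⟩
    4 * (1 + 2 * sizeH n)
      ≡⟨ cong (4 *_) (trans (cong (λ h → 1 + (sizeH n + h)) (+-identityʳ (sizeH n))) (sym (v₂-size n))) ⟩
    4 * v₂ (suc n) ∎
    where
    open ≡-Reasoning
    n+L : n + L ≡ 2 + (n + m)
    n+L = trans (+-suc n M) (cong suc (+-suc n m))

  v-next : v (L + L) ≡ 4 * (1 + 2 * sizeH M)
  v-next = trans (cong (λ k → v (2 + k)) (+-suc m M)) (trans (v-size (m + M)) (cong (λ h → 4 * (1 + 2 * h))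
    (trans (cong (λ k → sizeW 0 (suc k)) (sym (+-suc m M))) (octant-size M level M ≤-refl))))

-- Only the half that is not a stage late loses a cell here, hence 1 instead of 2.
v₁-last : ∀ m → Level (2 + m) → v₁ (3 + m + (2 + m)) + 1 ≡ 2 * v₁ (2 + m) + v₁ (2 + m + 1)
v₁-last m level = begin
  v₁ (3 + m + (2 + m)) + 1
    ≡⟨ cong (λ n → v₁ n + 1) (+-comm (3 + m) (2 + m)) ⟩
  v₁ (2 + (m + (3 + m))) + 1
    ≡⟨ cong (_+ 1) (v₁-size (m + (3 + m))) ⟩
  1 + (sizeH (1 + m + (3 + m)) + sizeH (m + (3 + m))) + 1
    ≡⟨ cong₂ (λ a b → 1 + (a + b) + 1) (sizeH-late (1 + m) level) (sizeH-early (2 + m) level m ≤-refl) ⟩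
  1 + (2 * sizeH (1 + m) + sizeH (2 + m) + (2 * sizeH m + (1 + sizeH (1 + m)))) + 1
    ≡⟨ shuffle (sizeH m) (sizeH (1 + m)) (sizeH (2 + m)) ⟩
  2 * (1 + (sizeH (1 + m) + sizeH m)) + (1 + (sizeH (2 + m) + sizeH (1 + m)))
    ≡⟨ cong₂ (λ a b → 2 * a + b) (sym (v₁-size m)) (trans (sym (v₁-size (1 + m))) (cong v₁ (+-comm 1 (2 + m)))) ⟩
  2 * v₁ (2 + m) + v₁ (2 + m + 1) ∎
  where
  open ≡-Reasoning
  shuffle : ∀ a b c → 1 + (2 * b + c + (2 * a + (1 + b))) + 1 ≡ 2 * (1 + (b + a)) + (1 + (c + b))
  shuffle = solve-∀

suc-mersenne : ∀ k → suc (mersenne k) ≡ 2 ^ suc k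
suc-mersenne zero = refl
suc-mersenne (suc k) = begin
  suc (suc (mersenne k) + mersenne k)     ≡⟨ sym (+-suc (suc (mersenne k)) (mersenne k)) ⟩
  suc (mersenne k) + suc (mersenne k)     ≡⟨ cong₂ _+_ (suc-mersenne k) (trans (suc-mersenne k) (sym (+-identityʳ _))) ⟩
  2 ^ suc (suc k) ∎
  where open ≡-Reasoning

mersenne-positive : ∀ k → ∃ λ m → mersenne k ≡ suc m
mersenne-positive zero = 0 , refl
mersenne-positive (suc k) = _ , refl

sizeH-mersenne : ∀ k → sizeH (mersenne k) + 1 ≡ 3 * 2 ^ k
sizeH-mersenne zero = refl
sizeH-mersenne (suc k) = begin
  sizeH (suc M + M) + 1     ≡⟨ cong (λ n → sizeH n + 1) (+-comm (suc M) M) ⟩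
  sizeH (M + suc M) + 1     ≡⟨ cong (_+ 1) (sizeH-last M (level k)) ⟩
  2 * sizeH M + 1 + 1       ≡⟨ shuffle (sizeH M) ⟩
  2 * (sizeH M + 1)         ≡⟨ cong (2 *_) (sizeH-mersenne k) ⟩
  2 * (3 * 2 ^ k)           ≡⟨ triple (2 ^ k) ⟩
  3 * 2 ^ suc k             ∎
  where
  open ≡-Reasoning
  M : ℕ
  M = mersenne k
  shuffle : ∀ h → 2 * h + 1 + 1 ≡ 2 * (h + 1)
  shuffle = solve-∀
  triple : ∀ p → 2 * (3 * p) ≡ 3 * (2 * p)
  triple = solve-∀

-- With `a j` for the left side, `sizeH-last` and `sizeH-late` give
-- `a (j + 1) = 2 * a j + 3 * 2 ^ (j + 1)`. The added term is in resonance with the doubling, whence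
-- the factor linear in `j`.
sizeH-consecutive : ∀ j m → mersenne (suc j) ≡ suc m → sizeH (suc m) + sizeH m ≡ (3 * (2 + j) + 1) * 2 ^ j
sizeH-consecutive zero m refl = refl
sizeH-consecutive (suc j) m eq with mersenne-positive (suc j)
... | l , eq′ = begin
  sizeH (suc m) + sizeH m
    ≡⟨ cong₂ (λ a b → sizeH a + sizeH b) (trans (sym eq) doubled) (suc-injective (trans (sym eq) doubled)) ⟩
  sizeH (suc l + (2 + l)) + sizeH (l + (2 + l))
    ≡⟨ cong₂ _+_ (sizeH-last (suc l) level′) (sizeH-late l level′) ⟩
  2 * sizeH (suc l) + 1 + (2 * sizeH l + sizeH (suc l))
    ≡⟨ shuffle (sizeH (suc l)) (sizeH l) ⟩
  2 * (sizeH (suc l) + sizeH l) + (sizeH (suc l) + 1)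
    ≡⟨ cong₂ (λ a b → 2 * a + b) (sizeH-consecutive j l eq′) (trans (cong (λ M → sizeH M + 1) (sym eq′)) (sizeH-mersenne (suc j))) ⟩
  2 * ((3 * (2 + j) + 1) * 2 ^ j) + 3 * (2 * 2 ^ j)
    ≡⟨ collect j (2 ^ j) ⟩
  (3 * (3 + j) + 1) * (2 * 2 ^ j) ∎
  where
  open ≡-Reasoning
  level′ : Level (suc l)
  level′ = subst Level eq′ (level (suc j))
  doubled : mersenne (2 + j) ≡ suc l + (2 + l)
  doubled = trans (cong (λ M → suc M + M) eq′) (cong suc (sym (+-suc l (suc l))))
  shuffle : ∀ a b → 2 * a + 1 + (2 * b + a) ≡ 2 * (a + b) + (a + 1)
  shuffle = solve-∀
  collect : ∀ j p → 2 * ((3 * (2 + j) + 1) * p) + 3 * (2 * p) ≡ (3 * (3 + j) + 1) * (2 * p)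
  collect = solve-∀

v₁-recurrence : ∀ k → 2 ≤ k →
  v₁ (2 ^ k) ≡ (3 * k + 1) * 2 ^ (k ∸ 2) + 1 ×
  v₁ (2 ^ k + 1) ≡ 3 * 2 ^ (k ∸ 1) + 3 ×
  (∀ i → 2 ≤ i → i ≤ 2 ^ k ∸ 2 → v₁ (2 ^ k + i) ≡ 2 * v₁ i + v₁ (i + 1)) ×
  v₁ (2 ^ k + (2 ^ k ∸ 1)) + 1 ≡ 2 * v₁ (2 ^ k ∸ 1) + v₁ (2 ^ k ∸ 1 + 1)
-- The power is abstracted to `L` so that it can be replaced by a successor, on which the truncated
-- subtractions compute.
v₁-recurrence (suc (suc j)) (s≤s (s≤s z≤n)) = at (2 ^ (2 + j)) (mersenne j + mersenne j) refl (sym (suc-mersenne (suc j)))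
  where
  positive : 0 < mersenne j + mersenne j
  positive with mersenne j | mersenne-positive j
  ... | _ | _ , refl = s≤s z≤n
  at : ∀ L m → mersenne (suc j) ≡ suc m → L ≡ suc (mersenne (suc j)) →
    v₁ L ≡ (3 * (2 + j) + 1) * 2 ^ j + 1 ×
    v₁ (L + 1) ≡ 3 * 2 ^ (1 + j) + 3 ×
    (∀ i → 2 ≤ i → i ≤ L ∸ 2 → v₁ (L + i) ≡ 2 * v₁ i + v₁ (i + 1)) ×
    v₁ (L + (L ∸ 1)) + 1 ≡ 2 * v₁ (L ∸ 1) + v₁ (L ∸ 1 + 1)
  at L m refl refl =
    trans (v₁-size m) (trans (cong suc (sizeH-consecutive j m refl)) (+-comm 1 ((3 * (2 + j) + 1) * 2 ^ j))) ,
    trans (Recurrences.v₁-second m (level (suc j)) positive) (cong (_+ 3) (sizeH-mersenne (suc j))) ,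
    Recurrences.v₁-early m (level (suc j)) ,
    last m positive (level (suc j))
    where
    last : ∀ m → 0 < m → Level (suc m) → v₁ (2 + m + suc m) + 1 ≡ 2 * v₁ (suc m) + v₁ (suc m + 1)
    last (suc m) _ = v₁-last m

v₂-recurrence : ∀ k → 1 ≤ k →
  v₂ (2 ^ k) + 1 ≡ 3 * 2 ^ k ×
  (∀ i → 1 ≤ i → i ≤ 2 ^ k ∸ 2 → v₂ (2 ^ k + i) ≡ v₂ i + 2 * v₁ (i + 1)) ×
  v₂ (2 ^ k + (2 ^ k ∸ 1)) + 2 ≡ v₂ (2 ^ k ∸ 1) + 2 * v₁ (2 ^ k ∸ 1 + 1)
v₂-recurrence (suc k) (s≤s z≤n) with mersenne-positive k
... | m , eq = power , subst (λ L → (∀ i → 1 ≤ i → i ≤ L ∸ 2 → v₂ (L + i) ≡ v₂ i + 2 * v₁ (i + 1)) ×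
    v₂ (L + (L ∸ 1)) + 2 ≡ v₂ (L ∸ 1) + 2 * v₁ (L ∸ 1 + 1)) (trans (cong suc (sym eq)) (suc-mersenne k))
    (Recurrences.v₂-early m level′ , Recurrences.v₂-last m level′)
  where
  level′ : Level (suc m)
  level′ = subst Level eq (level k)
  shuffle : ∀ h → 1 + (h + h) + 1 ≡ 2 * (h + 1)
  shuffle = solve-∀
  triple : ∀ p → 2 * (3 * p) ≡ 3 * (2 * p)
  triple = solve-∀
  open ≡-Reasoning
  power : v₂ (2 ^ suc k) + 1 ≡ 3 * 2 ^ suc k
  power = begin
    v₂ (2 ^ suc k) + 1                                   ≡⟨ cong (λ L → v₂ L + 1) (sym (suc-mersenne k)) ⟩
    v₂ (suc (mersenne k)) + 1                            ≡⟨ cong (_+ 1) (v₂-size (mersenne k)) ⟩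
    1 + (sizeH (mersenne k) + sizeH (mersenne k)) + 1    ≡⟨ shuffle (sizeH (mersenne k)) ⟩
    2 * (sizeH (mersenne k) + 1)                         ≡⟨ cong (2 *_) (sizeH-mersenne k) ⟩
    2 * (3 * 2 ^ k)                                      ≡⟨ triple (2 ^ k) ⟩
    3 * 2 ^ suc k                                        ∎

v-recurrence : ∀ k → 1 ≤ k →
  v (2 ^ k) + 4 ≡ 6 * 2 ^ k × (∀ i → 1 ≤ i → i ≤ 2 ^ k ∸ 1 → v (2 ^ k + i) ≡ 4 * v₂ i)
v-recurrence (suc k) (s≤s z≤n) = power k , copies k
  where
  copies : ∀ k i → 1 ≤ i → i ≤ 2 ^ suc k ∸ 1 → v (2 ^ suc k + i) ≡ 4 * v₂ i
  copies k with mersenne-positive k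
  ... | m , eq = subst (λ L → ∀ i → 1 ≤ i → i ≤ L ∸ 1 → v (L + i) ≡ 4 * v₂ i)
    (trans (cong suc (sym eq)) (suc-mersenne k)) (Recurrences.v-copy m (subst Level eq (level k)))
  power : ∀ k → v (2 ^ suc k) + 4 ≡ 6 * 2 ^ suc k
  -- `v-size` begins at stage 3, so `v 2` is evaluated directly.
  power zero = refl
  power (suc k) with mersenne-positive k
  ... | m , eq = begin
    v (2 ^ (2 + k)) + 4
      ≡⟨ cong (λ L → v L + 4) (cong₂ _+_ (sym L≡) (trans (+-identityʳ _) (sym L≡))) ⟩
    v (suc (suc m) + suc (suc m)) + 4
      ≡⟨ cong (_+ 4) (Recurrences.v-next m (subst Level eq (level k))) ⟩
    4 * (1 + 2 * sizeH (suc m)) + 4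
      ≡⟨ shuffle (sizeH (suc m)) ⟩
    8 * (sizeH (suc m) + 1)
      ≡⟨ cong (8 *_) (trans (cong (λ M → sizeH M + 1) (sym eq)) (sizeH-mersenne k)) ⟩
    8 * (3 * 2 ^ k)
      ≡⟨ collect (2 ^ k) ⟩
    6 * 2 ^ (2 + k) ∎
    where
    open ≡-Reasoning
    L≡ : suc (suc m) ≡ 2 ^ suc k
    L≡ = trans (cong suc (sym eq)) (suc-mersenne k)
    shuffle : ∀ h → 4 * (1 + 2 * h) + 4 ≡ 8 * (h + 1)
    shuffle = solve-∀
    collect : ∀ p → 8 * (3 * p) ≡ 6 * (2 * (2 * p))
    collect = solve-∀

theorem12 : (v₁ 0 ≡ 0 × v₁ 1 ≡ 1 × v₁ 2 ≡ 3 × v₁ 3 ≡ 5 ×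
    (∀ k → 2 ≤ k →
    v₁ (2 ^ k) ≡ (3 * k + 1) * 2 ^ (k ∸ 2) + 1 ×
    v₁ (2 ^ k + 1) ≡ 3 * 2 ^ (k ∸ 1) + 3 ×
    (∀ i → 2 ≤ i → i ≤ 2 ^ k ∸ 2 → v₁ (2 ^ k + i) ≡ 2 * v₁ i + v₁ (i + 1)) ×
    v₁ (2 ^ k + (2 ^ k ∸ 1)) + 1 ≡ 2 * v₁ (2 ^ k ∸ 1) + v₁ (2 ^ k ∸ 1 + 1)))
    ×
    (v₂ 0 ≡ 0 × v₂ 1 ≡ 1 ×
    (∀ k → 1 ≤ k →
    v₂ (2 ^ k) + 1 ≡ 3 * 2 ^ k ×
    (∀ i → 1 ≤ i → i ≤ 2 ^ k ∸ 2 → v₂ (2 ^ k + i) ≡ v₂ i + 2 * v₁ (i + 1)) ×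
    v₂ (2 ^ k + (2 ^ k ∸ 1)) + 2 ≡ v₂ (2 ^ k ∸ 1) + 2 * v₁ (2 ^ k ∸ 1 + 1)))
    ×
    (v 0 ≡ 0 × v 1 ≡ 1 ×
    (∀ k → 1 ≤ k →
    v (2 ^ k) + 4 ≡ 6 * 2 ^ k ×
    (∀ i → 1 ≤ i → i ≤ 2 ^ k ∸ 1 → v (2 ^ k + i) ≡ 4 * v₂ i)))
theorem12 = (refl , refl , refl , refl , v₁-recurrence) , (refl , refl , v₂-recurrence) , (refl , refl , v-recurrence)
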